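{- Let $n\ge2$, $\alpha,\beta>0$, $a=1/\alpha$, $b=1/\beta$, and let $1\le j_1<\dots<j_r\le n-1$. For $1\le j\le n-1$ let $x_j$ be the event that box $(n-j,j)$ (on the second main diagonal) is non-empty. If $j_k\le j_{k+1}-2$ for all $k=1,\dots,r-1$, then \[\mathbb{P}_{n,\alpha,\beta}(x_{j_1},\dots,x_{j_r})=\prod_{k=1}^{r}\frac{1}{n+a+b-r+k-1}.\] Otherwise, $\mathbb{P}_{n,\alpha,\beta}(x_{j_1},\dots,x_{j_r})=0$.
   Context: A staircase tableau of size $n$ has boxes $(i,j)$ with $i,j\ge1$ and $i+j\le n+1$, rows numbered from the top and columns from the left. An $\alpha/\beta$-staircase tableau of size $n$ is a filling in which each box is empty or contains $\alpha$ or $\beta$, such that: all boxes in the same column and above an $\alpha$ are empty; all boxes in the same row and to the left of a $\beta$ are empty; every main-diagonal box (with $i+j=n+1$) contains a symbol. $\overline{\mathcal{S}}_n$ is the set of these. The weight is $wt(S)=\alpha^{N_\alpha}\beta^{N_\beta}$ ($N_\alpha,N_\beta$ the numbers of $\alpha$'s, $\beta$'s), and $\mathbb{P}_{n,\alpha,\beta}(S)=wt(S)/\sum_{T\in\overline{\mathcal{S}}_n}wt(T)$. $\mathbb{P}_{n,\alpha,\beta}(E_1,\dots,E_r)$ denotes the probability of the intersection of the events. -}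

module Defs where

open import Algebra.Apartness.Bundles using (HeytingField; HeytingCommutativeRing)
open import Algebra.Bundles using (CommutativeRing; Semiring)
import Algebra.Apartness.Properties.HeytingCommutativeRing as HeytingProperties
import Algebra.Definitions.RawSemiring as RawSemiringDefs
import Algebra.Properties.Group as GroupProperties
import Algebra.Properties.Monoid.Mult as MonoidMult
open import Data.Empty using (⊥-elim)
open import Data.Fin.Base as Fin using (Fin; toℕ)
import Data.Fin.Properties as Fin
open import Data.List.Base as List using (List; []; _∷_)
open import Data.List.Membership.Propositional using (_∈_)
open import Data.List.Membership.Propositional.Properties
  using (∈-cartesianProductWith⁺; ∈-filter⁺; ∈-map⁺)
open import Data.List.Relation.Unary.All as All using (All; []; _∷_)
import Data.List.Relation.Unary.All.Properties as All
open import Data.List.Relation.Unary.Any using (here; there)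
open import Data.Maybe.Base using (Maybe; just; nothing)
import Data.Maybe.Properties as Maybe
open import Data.Nat.Base as ℕ using (ℕ; zero; suc; _∸_; z≤n; s≤s)
import Data.Nat.Properties as ℕ
open import Data.Product.Base using (∃; Σ-syntax; _×_; _,_; proj₁; uncurry)
open import Data.Sum.Base using (_⊎_; inj₁; inj₂)
open import Data.Vec.Base as Vec using (Vec; []; _∷_)
import Data.Vec.Properties as Vec
open import Level using (Level; _⊔_) renaming (suc to lsuc)
open import Relation.Binary.Core using (Rel)
open import Relation.Binary.Definitions using (DecidableEquality)
open import Relation.Binary.PropositionalEquality as ≡ using (_≡_; _≢_; refl)
open import Relation.Binary.Structures using (IsStrictPartialOrder)
open import Relation.Nullary using (¬_; Dec; yes; no)
open import Relation.Nullary.Decidable using (map′; ¬?; _×-dec_; _→-dec_)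
open import Relation.Unary using (Pred; Decidable)

private
  variable
    n r : ℕ

-- An ordered Heyting field: x # y means x < y or y < x.  Neither decidability
-- of the order nor an Archimedean axiom is required, so that the real numbers
-- are an instance both classically and constructively.

record OrderedField c ℓ₁ ℓ₂ ℓ₃ : Set (lsuc (c ⊔ ℓ₁ ⊔ ℓ₂ ⊔ ℓ₃)) where
  infix 4 _<_
  field
    heytingField : HeytingField c ℓ₁ ℓ₂

  open HeytingField heytingField public renaming (refl to ≈-refl)

  field
    _<_                  : Rel Carrier ℓ₃
    isStrictPartialOrder : IsStrictPartialOrder _≈_ _<_
    #⇒<                  : ∀ {x y} → x # y → x < y ⊎ y < x
    <⇒#                  : ∀ {x y} → x < y → x # y
    +-monoˡ-<            : ∀ z {x y} → x < y → x + z < y + z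
    *-positive           : ∀ {x y} → 0# < x → 0# < y → 0# < x * y

  open IsStrictPartialOrder isStrictPartialOrder public
    using (<-resp-≈; <-respˡ-≈; <-respʳ-≈)
    renaming (irrefl to <-irrefl; trans to <-trans; asym to <-asym)

  commutativeRing : CommutativeRing c ℓ₁
  commutativeRing = HeytingCommutativeRing.commutativeRing heytingCommutativeRing

  open CommutativeRing commutativeRing public
    using (semiring; +-group; +-monoid)

  open RawSemiringDefs (Semiring.rawSemiring semiring) public using (_^_)
    renaming (product to ∏; _×_ to _·_)

  fromℕ : ℕ → Carrier
  fromℕ n = n · 1#

  sumᴸ : List Carrier → Carrier
  sumᴸ = List.foldr _+_ 0#

  1/_[_] : ∀ x → 0# < x → Carrier
  1/ x [ x>0 ] = proj₁ (#⇒invertible (#-sym (<⇒# x>0)))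

  private
    x-0≈x : ∀ x → x - 0# ≈ x
    x-0≈x = HeytingProperties.x-0≈x heytingCommutativeRing

  1/-inverseˡ : ∀ {x} (x>0 : 0# < x) → 1/ x [ x>0 ] * x ≈ 1#
  1/-inverseˡ {x} x>0 with #⇒invertible (#-sym (<⇒# x>0))
  ... | y , y*x≈1 , _ = trans (*-congˡ (sym (x-0≈x x))) y*x≈1

  +-positive : ∀ {x y} → 0# < x → 0# < y → 0# < x + y
  +-positive {x} {y} x>0 y>0 =
    <-trans y>0 (<-respˡ-≈ (+-identityˡ y) (+-monoˡ-< y x>0))

  1-positive : 0# < 1#
  1-positive with #⇒< (HeytingProperties.1#0 heytingCommutativeRing)
  ... | inj₂ 0<1 = 0<1
  ... | inj₁ 1<0 = <-respʳ-≈ [-1]*[-1]≈1 (*-positive 0<-1 0<-1)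
    where
    open CommutativeRing commutativeRing using (ring)
    open import Algebra.Properties.Ring ring using (-1*x≈-x; -‿involutive)

    0<-1 : 0# < - 1#
    0<-1 = <-respˡ-≈ (-‿inverseʳ 1#)
             (<-respʳ-≈ (+-identityˡ (- 1#)) (+-monoˡ-< (- 1#) 1<0))

    [-1]*[-1]≈1 : - 1# * - 1# ≈ 1#
    [-1]*[-1]≈1 = trans (-1*x≈-x (- 1#)) (-‿involutive 1#)

  1/-positive : ∀ {x} (x>0 : 0# < x) → 0# < 1/ x [ x>0 ]
  1/-positive {x} x>0 with #⇒< y#0
    where
    module HP = HeytingProperties heytingCommutativeRing
    y#0 : 1/ x [ x>0 ] # 0#
    y#0 = HP.invertibleʳ⇒#
      (x , trans (*-congʳ (x-0≈x 1/ x [ x>0 ])) (1/-inverseˡ x>0))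
  ... | inj₂ 0<y = 0<y
  ... | inj₁ y<0 = ⊥-elim (<-irrefl ≈-refl (<-trans 1-positive 1<0))
    where
    open CommutativeRing commutativeRing using (ring)
    open import Algebra.Properties.Ring ring using (-‿distribˡ-*)
    y = 1/ x [ x>0 ]

    0<-y : 0# < - y
    0<-y = <-respˡ-≈ (-‿inverseʳ y)
             (<-respʳ-≈ (+-identityˡ (- y)) (+-monoˡ-< (- y) y<0))

    0<-1 : 0# < - 1#
    0<-1 = <-respʳ-≈ (trans (sym (-‿distribˡ-* y x)) (-‿cong (1/-inverseˡ x>0)))
             (*-positive 0<-y x>0)

    1<0 : 1# < 0#
    1<0 = <-respˡ-≈ (+-identityˡ 1#)
            (<-respʳ-≈ (-‿inverseˡ 1#) (+-monoˡ-< 1# 0<-1))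

  ^-positive : ∀ {x} k → 0# < x → 0# < x ^ k
  ^-positive zero    x>0 = 1-positive
  ^-positive (suc k) x>0 = *-positive x>0 (^-positive k x>0)

  fromℕ+-positive : ∀ k {x} → 0# < x → 0# < fromℕ k + x
  fromℕ+-positive zero    {x} x>0 = <-respʳ-≈ (sym (+-identityˡ x)) x>0
  fromℕ+-positive (suc k) {x} x>0 =
    <-respʳ-≈ (sym (+-assoc 1# (fromℕ k) x))
      (+-positive 1-positive (fromℕ+-positive k x>0))

  -- The inhabitant of xs excludes the empty list.
  sumᴸ-positive : ∀ {x} {xs} → x ∈ xs → All (0# <_) xs → 0# < sumᴸ xs
  sumᴸ-positive {xs = x ∷ []}     _ (x>0 ∷ [])   = <-respʳ-≈ (sym (+-identityʳ x)) x>0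
  sumᴸ-positive {xs = _ ∷ _ ∷ _} _ (x>0 ∷ xs>0) =
    +-positive x>0 (sumᴸ-positive (here refl) xs>0)

-- Box n is the staircase { (i , j) : i , j ≥ 1 , i + j ≤ n + 1 }: the row with
-- (zero-based) index i consists of n ∸ i boxes.  The functions row and col give
-- the one-based coordinates.

Box : ℕ → Set
Box n = Σ[ i ∈ Fin n ] Fin (n ∸ toℕ i)

row col : Box n → ℕ
row (i , _) = suc (toℕ i)
col (_ , j) = suc (toℕ j)

data Symbol : Set where
  alpha beta : Symbol

-- nothing is the empty box.
Cell : Set
Cell = Maybe Symbol

infix 4 _≟ˢ_ _≟ᶜ_

_≟ˢ_ : DecidableEquality Symbol
alpha ≟ˢ alpha = yes refl
alpha ≟ˢ beta  = no λ ()
beta  ≟ˢ alpha = no λ ()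
beta  ≟ˢ beta  = yes refl

_≟ᶜ_ : DecidableEquality Cell
_≟ᶜ_ = Maybe.≡-dec _≟ˢ_

-- Rows are listed from the top: below the top row of a staircase of size n + 1,
-- which has n + 1 boxes, there is a staircase of size n.

data Filling : ℕ → Set where
  []  : Filling zero
  _∷_ : Vec Cell (suc n) → Filling n → Filling (suc n)

infix 9 _!_
_!_ : Filling n → Box n → Cell
(v ∷ T) ! (Fin.zero  , j) = Vec.lookup v j
(v ∷ T) ! (Fin.suc i , j) = T ! (i , j)

#[_] : Symbol → Filling n → ℕ
#[ s ] []      = 0
#[ s ] (v ∷ T) = Vec.count (_≟ᶜ just s) v ℕ.+ #[ s ] T

record IsTableau {n} (T : Filling n) : Set where
  field
    above-alpha : ∀ b c → col c ≡ col b → row c ℕ.< row b →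
                  T ! b ≡ just alpha → T ! c ≡ nothing
    left-beta   : ∀ b c → row c ≡ row b → col c ℕ.< col b →
                  T ! b ≡ just beta → T ! c ≡ nothing
    diagonal    : ∀ b → row b ℕ.+ col b ≡ n ℕ.+ 1 → T ! b ≢ nothing

allBoxes? : ∀ {p} {P : Pred (Box n) p} → Decidable P → Dec (∀ b → P b)
allBoxes? P? = map′ uncurry (λ f i j → f (i , j))
  (Fin.all? λ i → Fin.all? λ j → P? (i , j))

anyBox? : ∀ {p} {P : Pred (Box n) p} → Decidable P → Dec (∃ P)
anyBox? P? = map′ (λ { (i , j , p) → (i , j) , p }) (λ { ((i , j) , p) → i , j , p })
  (Fin.any? λ i → Fin.any? λ j → P? (i , j))

isTableau? : Decidable (IsTableau {n})
isTableau? {n} T = map′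
  (λ { (p , q , d) → record { above-alpha = p ; left-beta = q ; diagonal = d } })
  (λ t → let open IsTableau t in above-alpha , left-beta , diagonal)
  (     (allBoxes? λ b → allBoxes? λ c →
           (col c ℕ.≟ col b) →-dec (row c ℕ.<? row b) →-dec
           (T ! b ≟ᶜ just alpha) →-dec (T ! c ≟ᶜ nothing))
  ×-dec (allBoxes? λ b → allBoxes? λ c →
           (row c ℕ.≟ row b) →-dec (col c ℕ.<? col b) →-dec
           (T ! b ≟ᶜ just beta) →-dec (T ! c ≟ᶜ nothing))
  ×-dec (allBoxes? λ b →
           (row b ℕ.+ col b ℕ.≟ n ℕ.+ 1) →-dec ¬? (T ! b ≟ᶜ nothing)))

cells : List Cell
cells = nothing ∷ just alpha ∷ just beta ∷ []

allVecs : ∀ n → List (Vec Cell n)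
allVecs zero    = [] ∷ []
allVecs (suc n) = List.cartesianProductWith _∷_ cells (allVecs n)

allFillings : ∀ n → List (Filling n)
allFillings zero    = [] ∷ []
allFillings (suc n) = List.cartesianProductWith _∷_ (allVecs (suc n)) (allFillings n)

tableaux : ∀ n → List (Filling n)
tableaux n = List.filter isTableau? (allFillings n)

NonEmptyAt : ℕ → ℕ → Pred (Filling n) _
NonEmptyAt i j T = ∃ λ b → row b ≡ i × col b ≡ j × T ! b ≢ nothing

X : ∀ n → ℕ → Pred (Filling n) _
X n j = NonEmptyAt (n ∸ j) j

X? : ∀ n j → Decidable (X n j)
X? n j T = anyBox? λ b →
  (row b ℕ.≟ n ∸ j) ×-dec (col b ℕ.≟ j) ×-dec ¬? (T ! b ≟ᶜ nothing)

Separated : (Fin r → ℕ) → Set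
Separated j = ∀ k l → toℕ l ≡ suc (toℕ k) → j k ℕ.+ 2 ℕ.≤ j l

∈-cells : ∀ c → c ∈ cells
∈-cells nothing      = here refl
∈-cells (just alpha) = there (here refl)
∈-cells (just beta)  = there (there (here refl))

∈-allVecs : (v : Vec Cell n) → v ∈ allVecs n
∈-allVecs []      = here refl
∈-allVecs (c ∷ v) = ∈-cartesianProductWith⁺ _∷_ (∈-cells c) (∈-allVecs v)

∈-allFillings : (T : Filling n) → T ∈ allFillings n
∈-allFillings []      = here refl
∈-allFillings (v ∷ T) = ∈-cartesianProductWith⁺ _∷_ (∈-allVecs v) (∈-allFillings T)

-- The tableau with α in every diagonal box and all other boxes empty shows that
-- the total weight is positive.

tabulate : (Box n → Cell) → Filling n
tabulate {zero}  f = []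
tabulate {suc n} f =
  Vec.tabulate (λ j → f (Fin.zero , j)) ∷ tabulate λ { (i , j) → f (Fin.suc i , j) }

!-tabulate : (f : Box n → Cell) → ∀ b → tabulate f ! b ≡ f b
!-tabulate f (Fin.zero  , j) = Vec.lookup∘tabulate (λ j → f (Fin.zero , j)) j
!-tabulate f (Fin.suc i , j) = !-tabulate (λ { (i , j) → f (Fin.suc i , j) }) (i , j)

diagonalCell : Box n → Cell
diagonalCell {n} b with row b ℕ.+ col b ℕ.≟ n ℕ.+ 1
... | yes _ = just alpha
... | no  _ = nothing

diagonalTableau : ∀ n → Filling n
diagonalTableau n = tabulate diagonalCell

diagonalTableau-isTableau : ∀ n → IsTableau (diagonalTableau n)
diagonalTableau-isTableau n = record
  { above-alpha = λ b c colEq rowLt eq →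
      ≡.trans (!-tabulate diagonalCell c)
        (off-diagonal c λ onC →
          ℕ.<-irrefl (≡.trans onC (≡.sym (alpha⇒diagonal b (≡.trans (≡.sym (!-tabulate diagonalCell b)) eq))))
            (ℕ.+-mono-<-≤ rowLt (ℕ.≤-reflexive colEq)))
  ; left-beta = λ b c _ _ eq →
      ⊥-elim (not-beta b (≡.trans (≡.sym (!-tabulate diagonalCell b)) eq))
  ; diagonal = λ b on eq →
      on-diagonal b on (≡.trans (≡.sym (!-tabulate diagonalCell b)) eq)
  }
  where
  off-diagonal : ∀ (b : Box n) → row b ℕ.+ col b ≢ n ℕ.+ 1 → diagonalCell b ≡ nothing
  off-diagonal b off with row b ℕ.+ col b ℕ.≟ n ℕ.+ 1
  ... | yes on = ⊥-elim (off on)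
  ... | no  _  = refl

  on-diagonal : ∀ (b : Box n) → row b ℕ.+ col b ≡ n ℕ.+ 1 → diagonalCell b ≢ nothing
  on-diagonal b on with row b ℕ.+ col b ℕ.≟ n ℕ.+ 1
  ... | yes _   = λ ()
  ... | no  off = ⊥-elim (off on)

  alpha⇒diagonal : ∀ (b : Box n) → diagonalCell b ≡ just alpha → row b ℕ.+ col b ≡ n ℕ.+ 1
  alpha⇒diagonal b eq with row b ℕ.+ col b ℕ.≟ n ℕ.+ 1
  alpha⇒diagonal b eq | yes on = on
  alpha⇒diagonal b () | no  _

  not-beta : ∀ (b : Box n) → diagonalCell b ≢ just beta
  not-beta b eq with row b ℕ.+ col b ℕ.≟ n ℕ.+ 1
  not-beta b () | yes _
  not-beta b () | no  _

diagonalTableau-∈ : ∀ n → diagonalTableau n ∈ tableaux n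
diagonalTableau-∈ n =
  ∈-filter⁺ isTableau? (∈-allFillings (diagonalTableau n)) (diagonalTableau-isTableau n)

module Probability {c ℓ₁ ℓ₂ ℓ₃} (F : OrderedField c ℓ₁ ℓ₂ ℓ₃) where
  open OrderedField F

  module _ {α β : Carrier} (α>0 : 0# < α) (β>0 : 0# < β) where

    wt : Filling n → Carrier
    wt S = α ^ #[ alpha ] S * β ^ #[ beta ] S

    totalWeight : ℕ → Carrier
    totalWeight n = sumᴸ (List.map wt (tableaux n))

    totalWeight>0 : ∀ n → 0# < totalWeight n
    totalWeight>0 n = sumᴸ-positive (∈-map⁺ wt (diagonalTableau-∈ n))
      (All.map⁺ (All.universal
        (λ S → *-positive (^-positive (#[ alpha ] S) α>0) (^-positive (#[ beta ] S) β>0))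
        (tableaux n)))

    prob : Filling n → Carrier
    prob {n} S = wt S * 1/ totalWeight n [ totalWeight>0 n ]

    -- The probability of the intersection of the events E k, for k : Fin r.
    ℙ : ∀ n {r p} {E : Fin r → Pred (Filling n) p} → (∀ k → Decidable (E k)) → Carrier
    ℙ n E? = sumᴸ (List.map prob
      (List.filter (λ S → Fin.all? (λ k → E? k S)) (tableaux n)))

  denominator>0 : ∀ {a b} → 0# < a → 0# < b → ∀ n {r} → r ℕ.≤ n → (i : Fin r) →
                  0# < fromℕ n + a + b - fromℕ r + fromℕ (suc (toℕ i)) - 1#
  denominator>0 {a} {b} a>0 b>0 n {r} r≤n i =
    <-respʳ-≈ (sym eq) (fromℕ+-positive (n ∸ r ℕ.+ toℕ i) (+-positive a>0 b>0))
    where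
    open import Relation.Binary.Reasoning.Setoid setoid
    open GroupProperties +-group using (//-rightDividesʳ)
    open MonoidMult +-monoid using (×-homo-+)
    open CommutativeRing commutativeRing using (+-commutativeMonoid)
    open import Algebra.Solver.CommutativeMonoid +-commutativeMonoid
      using (solve; _⊜_; _⊕_)
    M = fromℕ (n ∸ r)
    R = fromℕ r
    I = fromℕ (toℕ i)

    n≈M+R : fromℕ n ≈ M + R
    n≈M+R = begin
      fromℕ n              ≡⟨ ≡.cong fromℕ (ℕ.m∸n+n≡m r≤n) ⟨
      fromℕ (n ∸ r ℕ.+ r)  ≈⟨ ×-homo-+ 1# (n ∸ r) r ⟩
      M + R                ∎

    eq : fromℕ n + a + b - R + (1# + I) - 1# ≈ fromℕ (n ∸ r ℕ.+ toℕ i) + (a + b)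
    eq = begin
      fromℕ n + a + b - R + (1# + I) - 1#
        ≈⟨ +-congʳ (+-congʳ (+-congʳ (+-congʳ (+-congʳ n≈M+R)))) ⟩
      M + R + a + b - R + (1# + I) - 1#
        ≈⟨ +-congʳ (+-congʳ (+-congʳ (solve 4
             (λ m r a b → (((m ⊕ r) ⊕ a) ⊕ b) ⊜ ((m ⊕ (a ⊕ b)) ⊕ r)) ≈-refl M R a b))) ⟩
      M + (a + b) + R - R + (1# + I) - 1#
        ≈⟨ +-congʳ (+-congʳ (//-rightDividesʳ R (M + (a + b)))) ⟩
      M + (a + b) + (1# + I) - 1#
        ≈⟨ +-congʳ (solve 4
             (λ m s o i → ((m ⊕ s) ⊕ (o ⊕ i)) ⊜ (((m ⊕ i) ⊕ s) ⊕ o)) ≈-refl M (a + b) 1# I) ⟩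
      M + I + (a + b) + 1# - 1#
        ≈⟨ //-rightDividesʳ 1# (M + I + (a + b)) ⟩
      M + I + (a + b)
        ≈⟨ +-congʳ (×-homo-+ 1# (n ∸ r) (toℕ i)) ⟨
      fromℕ (n ∸ r ℕ.+ toℕ i) + (a + b) ∎

-- A strictly increasing sequence of length r in {1 , … , n - 1} has r ≤ n.

StrictlyIncreasing : (Fin r → ℕ) → Set
StrictlyIncreasing j = ∀ k l → k Fin.< l → j k ℕ.< j l

length≤ : (j : Fin r → ℕ) → (∀ k → 1 ℕ.≤ j k) → (∀ k → j k ℕ.≤ n ∸ 1) →
          StrictlyIncreasing j → r ℕ.≤ n
length≤ {zero}      {n} j lo hi inc = z≤n
length≤ {r = suc r} {n} j lo hi inc =
  ℕ.≤-trans (≡.subst (λ i → suc i ℕ.≤ j (Fin.fromℕ r)) (Fin.toℕ-fromℕ r) (index< (Fin.fromℕ r)))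
    (ℕ.≤-trans (hi (Fin.fromℕ r)) (ℕ.m∸n≤m n 1))
  where
  bound : ∀ m (k : Fin (suc r)) → toℕ k ≡ m → suc m ℕ.≤ j k
  bound zero    k           eq = lo k
  bound (suc m) (Fin.suc k) eq =
    ℕ.≤-trans (s≤s (bound m (Fin.inject₁ k) (≡.trans (Fin.toℕ-inject₁ k) (ℕ.suc-injective eq))))
      (inc (Fin.inject₁ k) (Fin.suc k)
        (ℕ.≤-reflexive (≡.cong suc (Fin.toℕ-inject₁ k))))

  index< : ∀ k → suc (toℕ k) ℕ.≤ j k
  index< k = bound (toℕ k) k refl

{-# OPTIONS --safe #-}

-- Let D n x be the sum of wt S * x ^ f over the tableaux S of size n, where f is the number of
-- columns of S without α; only above these columns may a further top row have symbols.
-- Reading the new row from the left, all its symbols but the first are α, which gives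
--   D (n + 1) x = (α + β x) D n (x + α),    D n 1 = ∏ (i < n) (α + β + i α β).
-- If the second box from the right in the top row is non-empty, then the diagonal box below it
-- contains β, the one to its right contains α, and the row of this β and the column of this α
-- are otherwise empty.  Removing them leaves an arbitrary tableau of size n - 1, so every event
-- contributes a factor α β and lowers n by one: r separated events have total weight
-- (α β)^r D (n - r) 1.

module Submission where

open import Algebra.Bundles using (CommutativeRing; CommutativeSemiring)
import Algebra.Properties.Group as GroupProperties
open import Data.Bool.Base using (Bool; true; false; not; _∧_; T; if_then_else_)
open import Data.Bool.Properties using (T-∧)
open import Data.Empty using (⊥; ⊥-elim)
open import Data.Fin.Base as Fin using (Fin; zero; suc; toℕ; fromℕ<; inject₁)
import Data.Fin.Properties as Fin
open import Data.Fin.Relation.Unary.Top using (view; ‵fromℕ; ‵inj₁)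
open import Data.List.Base as List using (List; []; _∷_; _++_)
import Data.List.Properties as List
import Data.List.Relation.Unary.All as All
import Data.List.Relation.Unary.All.Properties as All
open import Data.Maybe.Base using (just; nothing; is-just)
open import Data.Nat.Base as ℕ using (ℕ; zero; suc; _≤_; _∸_; z≤n; s≤s)
import Data.Nat.Properties as ℕ
open import Data.Product.Base using (∃; Σ-syntax; _×_; _,_; proj₂)
open import Data.Sum.Base using (_⊎_; inj₁; inj₂)
open import Data.Unit.Base using (tt)
open import Data.Vec.Base as Vec using (Vec; []; _∷_; lookup; countᵇ)
open import Function.Base using (_∘_; id)
open import Function.Bundles using (_⇔_; mk⇔; Equivalence)
open import Function.Construct.Composition using (_⇔-∘_)
open import Level using (Level)
open import Relation.Binary.PropositionalEquality as ≡ using (_≡_; _≢_)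
open import Relation.Nullary using (¬_; does; yes; no; contradiction)
open import Relation.Nullary.Decidable using (does-⇔; T?)
open import Relation.Unary using (Pred; Decidable)
open import Defs

open Equivalence using (to; from)

private
  variable
    ℓᵃ ℓᵇ ℓᶜ p : Level
    A : Set ℓᵃ
    B : Set ℓᵇ
    C : Set ℓᶜ
    n r : ℕ

-- Validity of fillings, checked row by row from the bottom.

keepsFree : Cell → Bool → Bool
keepsFree (just alpha) _ = false
keepsFree nothing      f = f
keepsFree (just beta)  f = f

extendFree : Vec Cell (suc n) → Vec Bool n → Vec Bool (suc n)
extendFree (c ∷ _) []       = keepsFree c true ∷ []
extendFree (c ∷ v) (f ∷ fs) = keepsFree c f ∷ extendFree v fs

-- Entry j tells whether column j + 1 contains no α, so that boxes above it may be filled.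
αFree : Filling n → Vec Bool n
αFree []      = []
αFree (v ∷ S) = extendFree v (αFree S)

seen : Bool → Cell → Bool
seen s nothing  = s
seen s (just _) = true

allowed : Bool → Cell → Bool → Bool
allowed s nothing      f = true
allowed s (just alpha) f = f
allowed s (just beta)  f = not s ∧ f

-- validRow s v fs: the row v may be put on top of a tableau with α-free columns fs,
-- where s tells whether a symbol occurs to the left of v.
validRow : Bool → Vec Cell (suc n) → Vec Bool n → Bool
validRow s (c ∷ _) []       = is-just c ∧ allowed s c true
validRow s (c ∷ v) (f ∷ fs) = allowed s c f ∧ validRow (seen s c) v fs

valid : Filling n → Bool
valid []      = true
valid (v ∷ S) = validRow false v (αFree S) ∧ valid S

-- The pointwise counterpart of `validRow`. `closed` ranges over all columns but the last, which
-- starts in this row; `no-beta` carries the information of the flag through inductions along the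
-- row.
record IsRow (s : Bool) (v : Vec Cell (suc n)) (fs : Vec Bool n) : Set where
  field
    closed  : ∀ i → lookup fs i ≡ false → lookup v (inject₁ i) ≡ nothing
    left    : ∀ i k → i Fin.< k → lookup v k ≡ just beta → lookup v i ≡ nothing
    last    : lookup v (Fin.fromℕ n) ≢ nothing
    no-beta : T s → ∀ k → lookup v k ≢ just beta

open IsRow

-- After a symbol the flag of the tail is `true`, so `no-beta` of the tail rules out every β to the
-- right of that symbol; this is what `left` asks of the head.
validRow⇒IsRow : ∀ s (v : Vec Cell (suc n)) fs → T (validRow s v fs) → IsRow s v fs
validRow⇒IsRow s (just alpha ∷ []) [] ok = record
  { closed = λ () ; left = λ { zero zero () } ; last = λ () ; no-beta = λ { _ zero () } }
validRow⇒IsRow false (just beta ∷ []) [] ok = record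
  { closed = λ () ; left = λ { zero zero () } ; last = λ () ; no-beta = λ () }
validRow⇒IsRow s (nothing ∷ v) (f ∷ fs) ok = record
  { closed  = λ { zero _ → ≡.refl ; (suc i) → closed tail i }
  ; left    = λ { zero _ _ _ → ≡.refl ; (suc i) (suc k) (s≤s i<k) → left tail i k i<k }
  ; last    = last tail
  ; no-beta = λ { s zero () ; s (suc k) → no-beta tail s k }
  }
  where tail = validRow⇒IsRow s v fs ok
validRow⇒IsRow s (just alpha ∷ v) (true ∷ fs) ok = record
  { closed  = λ { zero () ; (suc i) → closed tail i }
  ; left    = λ { zero (suc k) _ eq → contradiction eq (no-beta tail tt k)
                ; (suc i) (suc k) (s≤s i<k) → left tail i k i<k }
  ; last    = last tail
  ; no-beta = λ { s zero () ; s (suc k) → no-beta tail tt k }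
  }
  where tail = validRow⇒IsRow true v fs ok
validRow⇒IsRow false (just beta ∷ v) (true ∷ fs) ok = record
  { closed  = λ { zero () ; (suc i) → closed tail i }
  ; left    = λ { zero (suc k) _ eq → contradiction eq (no-beta tail tt k)
                ; (suc i) (suc k) (s≤s i<k) → left tail i k i<k }
  ; last    = last tail
  ; no-beta = λ ()
  }
  where tail = validRow⇒IsRow true v fs ok

IsRow-tail : ∀ {s t c f} {v : Vec Cell (suc n)} {fs} →
             (T t → ∀ k → lookup v k ≢ just beta) →
             IsRow s (c ∷ v) (f ∷ fs) → IsRow t v fs
IsRow-tail no-beta′ p = record
  { closed  = λ i → closed p (suc i)
  ; left    = λ i k i<k → left p (suc i) (suc k) (s≤s i<k)
  ; last    = last p
  ; no-beta = no-beta′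
  }

IsRow⇒validRow : ∀ s (v : Vec Cell (suc n)) fs → IsRow s v fs → T (validRow s v fs)
IsRow⇒validRow s     (nothing ∷ [])    [] p = last p ≡.refl
IsRow⇒validRow s     (just alpha ∷ []) [] p = tt
IsRow⇒validRow false (just beta ∷ [])  [] p = tt
IsRow⇒validRow true  (just beta ∷ [])  [] p = no-beta p tt zero ≡.refl
IsRow⇒validRow s (nothing ∷ v) (f ∷ fs) p =
  IsRow⇒validRow s v fs (IsRow-tail (λ s k → no-beta p s (suc k)) p)
IsRow⇒validRow s (just alpha ∷ v) (false ∷ fs) p with () ← closed p zero ≡.refl
IsRow⇒validRow s (just alpha ∷ v) (true ∷ fs) p = IsRow⇒validRow true v fs
  (IsRow-tail (λ _ k eq → contradiction (left p zero (suc k) (s≤s z≤n) eq) λ ()) p)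
IsRow⇒validRow true  (just beta ∷ v) (f ∷ fs)     p = ⊥-elim (no-beta p tt zero ≡.refl)
IsRow⇒validRow false (just beta ∷ v) (false ∷ fs) p with () ← closed p zero ≡.refl
IsRow⇒validRow false (just beta ∷ v) (true ∷ fs)  p = IsRow⇒validRow true v fs
  (IsRow-tail (λ _ k eq → contradiction (left p zero (suc k) (s≤s z≤n) eq) λ ()) p)

-- The columns below the row are indexed by a smaller `Fin`, so the column is matched through `toℕ`.
extendFree-false⁻ : ∀ (v : Vec Cell (suc n)) fs i → lookup (extendFree v fs) i ≡ false →
                    lookup v i ≡ just alpha ⊎ ∃ λ k → toℕ k ≡ toℕ i × lookup fs k ≡ false
extendFree-false⁻ (just alpha ∷ _) []       zero eq = inj₁ ≡.refl
extendFree-false⁻ (just alpha ∷ _) (f ∷ fs) zero eq = inj₁ ≡.refl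
extendFree-false⁻ (nothing ∷ _)    (f ∷ fs) zero eq = inj₂ (zero , ≡.refl , eq)
extendFree-false⁻ (just beta ∷ _)  (f ∷ fs) zero eq = inj₂ (zero , ≡.refl , eq)
extendFree-false⁻ (c ∷ v) (f ∷ fs) (suc i) eq with extendFree-false⁻ v fs i eq
... | inj₁ α              = inj₁ α
... | inj₂ (k , k≡i , eq) = inj₂ (suc k , ≡.cong suc k≡i , eq)

extendFree-alpha : ∀ (v : Vec Cell (suc n)) fs i → lookup v i ≡ just alpha →
                   lookup (extendFree v fs) i ≡ false
extendFree-alpha (just alpha ∷ _) []       zero    eq = ≡.refl
extendFree-alpha (just alpha ∷ _) (f ∷ fs) zero    eq = ≡.refl
extendFree-alpha (c ∷ v)          (f ∷ fs) (suc i) eq = extendFree-alpha v fs i eq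

extendFree-false⁺ : ∀ (v : Vec Cell (suc n)) fs i → lookup fs i ≡ false →
                    lookup (extendFree v fs) (inject₁ i) ≡ false
extendFree-false⁺ (nothing ∷ _)    (f ∷ fs) zero eq = eq
extendFree-false⁺ (just alpha ∷ _) (f ∷ fs) zero eq = ≡.refl
extendFree-false⁺ (just beta ∷ _)  (f ∷ fs) zero eq = eq
extendFree-false⁺ (_ ∷ v) (f ∷ fs) (suc i) eq = extendFree-false⁺ v fs i eq

αFree-false⁻ : ∀ (S : Filling n) i → lookup (αFree S) i ≡ false →
               ∃ λ b → toℕ (proj₂ b) ≡ toℕ i × S ! b ≡ just alpha
αFree-false⁻ (v ∷ S) i eq with extendFree-false⁻ v (αFree S) i eq
... | inj₁ α = (zero , i) , ≡.refl , α
... | inj₂ (k , k≡i , eq′) with αFree-false⁻ S k eq′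
...   | (l , j) , j≡k , α = (suc l , j) , ≡.trans j≡k k≡i , α

αFree-false⁺ : ∀ (S : Filling n) b i → toℕ (proj₂ b) ≡ toℕ i → S ! b ≡ just alpha →
               lookup (αFree S) i ≡ false
αFree-false⁺ (v ∷ S) (zero , j) i j≡i α with ≡.refl ← Fin.toℕ-injective j≡i =
  extendFree-alpha v (αFree S) i α
αFree-false⁺ {suc n} (v ∷ S) (suc l , j) i j≡i α =
  ≡.subst (λ i → lookup (αFree (v ∷ S)) i ≡ false) k≡i
    (extendFree-false⁺ v (αFree S) k (αFree-false⁺ S (l , j) k (≡.sym (Fin.toℕ-fromℕ< j<n)) α))
  where
  j<n : toℕ j ℕ.< n
  j<n = ℕ.<-≤-trans (Fin.toℕ<n j) (ℕ.m∸n≤m n (toℕ l))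
  k = fromℕ< j<n
  k≡i : inject₁ k ≡ i
  k≡i = Fin.toℕ-injective (≡.trans (Fin.toℕ-inject₁ k) (≡.trans (Fin.toℕ-fromℕ< j<n) j≡i))

open IsTableau

IsTableau-∷⁻ : ∀ {v : Vec Cell (suc n)} {S} → IsTableau (v ∷ S) →
               IsRow false v (αFree S) × IsTableau S
IsTableau-∷⁻ {n} {v} {S} t = record
  { closed  = λ i eq → let (l , j) , j≡i , α = αFree-false⁻ S i eq in
      above-alpha t (suc l , j) (zero , inject₁ i)
        (≡.cong suc (≡.trans (Fin.toℕ-inject₁ i) (≡.sym j≡i))) (s≤s (s≤s z≤n)) α
  ; left    = λ i k i<k → left-beta t (zero , k) (zero , i) ≡.refl (s≤s i<k)
  ; last    = diagonal t (zero , Fin.fromℕ n)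
      (≡.cong suc (≡.trans (≡.cong suc (Fin.toℕ-fromℕ n)) (ℕ.+-comm 1 n)))
  ; no-beta = λ ()
  } , record
  { above-alpha = λ { (i , j) (k , l) col≡ row< →
      above-alpha t (suc i , j) (suc k , l) col≡ (s≤s row<) }
  ; left-beta   = λ { (i , j) (k , l) row≡ col< →
      left-beta t (suc i , j) (suc k , l) (≡.cong suc row≡) col< }
  ; diagonal    = λ { (i , j) on → diagonal t (suc i , j) (≡.cong suc on) }
  }

-- Two boxes tied by one of the emptiness conditions both lie in `S`, both lie in the top row, or
-- are an α of `S` and the top box of its column. These cases are settled by `t`, `left` and
-- `closed`.
IsTableau-∷⁺ : ∀ {v : Vec Cell (suc n)} {S} → IsRow false v (αFree S) → IsTableau S →
               IsTableau (v ∷ S)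
IsTableau-∷⁺ {n} {v} {S} p t = record
  { above-alpha = λ
      { (zero , j)  (zero , l)  _ (s≤s ())
      ; (zero , j)  (suc k , l) _ (s≤s ())
      ; (suc i , j) (zero , l)  col≡ _ α → above i j l (≡.sym (ℕ.suc-injective col≡)) α
      ; (suc i , j) (suc k , l) col≡ (s≤s row<) α → above-alpha t (i , j) (k , l) col≡ row< α
      }
  ; left-beta = λ
      { (zero , j)  (zero , l)  _ (s≤s col<) β → left p l j col< β
      ; (suc i , j) (suc k , l) row≡ col< β →
          left-beta t (i , j) (k , l) (ℕ.suc-injective row≡) col< β
      }
  ; diagonal = λ
      { (zero , j)  on eq → last p (≡.subst (λ j → lookup v j ≡ nothing) (top on) eq)
      ; (suc i , j) on → diagonal t (i , j) (ℕ.suc-injective on)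
      }
  }
  where
  top : ∀ {j : Fin (suc n)} → 1 ℕ.+ suc (toℕ j) ≡ suc n ℕ.+ 1 → j ≡ Fin.fromℕ n
  top {j} on = Fin.toℕ-injective (≡.trans
    (ℕ.suc-injective (≡.trans (ℕ.suc-injective on) (ℕ.+-comm n 1))) (≡.sym (Fin.toℕ-fromℕ n)))

  above : ∀ i (j : Fin (n ∸ toℕ i)) l → toℕ j ≡ toℕ l → S ! (i , j) ≡ just alpha →
          lookup v l ≡ nothing
  above i j l j≡l α = ≡.subst (λ l → lookup v l ≡ nothing) k≡l
    (closed p k (αFree-false⁺ S (i , j) k (≡.sym (Fin.toℕ-fromℕ< j<n)) α))
    where
    j<n : toℕ j ℕ.< n
    j<n = ℕ.<-≤-trans (Fin.toℕ<n j) (ℕ.m∸n≤m n (toℕ i))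
    k = fromℕ< j<n
    k≡l : inject₁ k ≡ l
    k≡l = Fin.toℕ-injective (≡.trans (Fin.toℕ-inject₁ k) (≡.trans (Fin.toℕ-fromℕ< j<n) j≡l))

-- Replaces conditions on all pairs of boxes by a recursion on rows, along which sums over tableaux
-- can be expanded.
IsTableau⇔valid : (S : Filling n) → IsTableau S ⇔ T (valid S)
IsTableau⇔valid []      = mk⇔ _ λ _ → record
  { above-alpha = λ { (() , _) } ; left-beta = λ { (() , _) } ; diagonal = λ { (() , _) } }
IsTableau⇔valid (v ∷ S) = mk⇔
  (λ t → let p , t′ = IsTableau-∷⁻ t in
    from (T-∧ {validRow false v (αFree S)})
      (IsRow⇒validRow false v (αFree S) p , to (IsTableau⇔valid S) t′))
  (λ ok → let p , t′ = to (T-∧ {validRow false v (αFree S)}) ok in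
    IsTableau-∷⁺ (validRow⇒IsRow false v (αFree S) p) (from (IsTableau⇔valid S) t′))

-- Separated index sets and their events.

-- Sparse n r: sets of r pairwise non-adjacent elements of {1 , … , n - 1};
-- take turns such a set into one in {1 , … , n + 1} by adding n + 1.
data Sparse : ℕ → ℕ → Set where
  empty : Sparse 0 0
  skip  : Sparse n r → Sparse (suc n) r
  take  : Sparse n r → Sparse (suc (suc n)) (suc r)

penultimate : Vec Cell (suc (suc n)) → Bool
penultimate {n} v = is-just (lookup v (inject₁ (Fin.fromℕ n)))

-- The largest possible index belongs to the top row, so the constructors are consumed together with
-- the rows from the top. For `take`, the row `w` is passed over because separation excludes the
-- index `n`.
hits : Sparse n r → Filling n → Bool
hits empty    S           = true
hits (skip σ) (v ∷ S)     = hits σ S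
hits (take σ) (v ∷ w ∷ S) = penultimate v ∧ hits σ S

-- Removing the top row lowers the size and the row number by one and keeps the column; `j < n` says
-- that the box is not in the removed row.
X-∷ : ∀ {j} (v : Vec Cell (suc n)) S → j ℕ.< n → X (suc n) j (v ∷ S) ⇔ X n j S
X-∷ {n} {j} v S j<n = mk⇔
  (λ { ((zero , _) , row≡ , _) →
         ⊥-elim (ℕ.<⇒≢ (ℕ.m<n⇒0<n∸m j<n) (ℕ.suc-injective (≡.trans row≡ eq)))
     ; ((suc i , k) , row≡ , col≡ , ne) →
         (i , k) , ℕ.suc-injective (≡.trans row≡ eq) , col≡ , ne })
  (λ { ((i , k) , row≡ , col≡ , ne) →
         (suc i , k) , ≡.trans (≡.cong suc row≡) (≡.sym eq) , col≡ , ne })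
  where
  eq : suc n ∸ j ≡ suc (n ∸ j)
  eq = ℕ.+-∸-assoc 1 (ℕ.<⇒≤ j<n)

is-just⇔ : (c : Cell) → c ≢ nothing ⇔ T (is-just c)
is-just⇔ nothing  = mk⇔ (λ ne → ne ≡.refl) λ ()
is-just⇔ (just _) = mk⇔ _ λ _ ()

X-top : ∀ (v : Vec Cell (suc (suc n))) S → X (suc (suc n)) (suc n) (v ∷ S) ⇔ T (penultimate v)
X-top {n} v S = mk⇔
  (λ { ((zero , k) , _ , col≡ , ne) → to (is-just⇔ _)
         (≡.subst (λ k → lookup v k ≢ nothing)
           (Fin.toℕ-injective (≡.trans (ℕ.suc-injective col≡) (≡.sym toℕ-penultimate))) ne)
     ; ((suc i , k) , row≡ , _) → contradiction (≡.trans row≡ 1≡) λ () })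
  (λ ne →
    (zero , inject₁ (Fin.fromℕ n)) , ≡.sym 1≡ , ≡.cong suc toℕ-penultimate , from (is-just⇔ _) ne)
  where
  toℕ-penultimate : toℕ (inject₁ (Fin.fromℕ n)) ≡ n
  toℕ-penultimate = ≡.trans (Fin.toℕ-inject₁ _) (Fin.toℕ-fromℕ n)
  1≡ : suc n ∸ n ≡ 1
  1≡ = ℕ.m+n∸n≡m 1 n

increasing⇒monotone : {j : Fin r → ℕ} → StrictlyIncreasing j → ∀ {k l} → k Fin.≤ l → j k ≤ j l
increasing⇒monotone {j = j} inc {k} {l} k≤l with ℕ.m≤n⇒m<n∨m≡n k≤l
... | inj₁ k<l = ℕ.<⇒≤ (inc k l k<l)
... | inj₂ k≡l = ℕ.≤-reflexive (≡.cong j (Fin.toℕ-injective k≡l))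

Encodes : Sparse n r → (Fin r → ℕ) → Set
Encodes {n} σ j = ∀ S → (∀ k → X n (j k) S) ⇔ T (hits σ S)

skip-encodes : ∀ {σ : Sparse n r} {j} → (∀ k → j k ℕ.< n) → Encodes σ j → Encodes (skip σ) j
skip-encodes j<n enc (v ∷ S) = mk⇔
  (λ x → to (enc S) λ k → to (X-∷ v S (j<n k)) (x k))
  (λ h k → from (X-∷ v S (j<n k)) (from (enc S) h k))

take-encodes : ∀ {σ : Sparse n r} {j} → (∀ k → j (inject₁ k) ℕ.< n) → j (Fin.fromℕ r) ≡ suc n →
               Encodes σ (j ∘ inject₁) → Encodes (take σ) j
take-encodes {n} {r} {σ} {j} j<n j≡ enc (v ∷ w ∷ S) = mk⇔
  (λ x → from T-∧ (to top (x (Fin.fromℕ r)) , to (enc S) λ k → to (below k) (x (inject₁ k))))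
  (λ h → all (to (T-∧ {penultimate v}) h))
  where
  top : X (suc (suc n)) (j (Fin.fromℕ r)) (v ∷ w ∷ S) ⇔ T (penultimate v)
  top = ≡.subst (λ i → X _ i (v ∷ w ∷ S) ⇔ T (penultimate v)) (≡.sym j≡) (X-top v (w ∷ S))

  below : ∀ k → X (suc (suc n)) (j (inject₁ k)) (v ∷ w ∷ S) ⇔ X n (j (inject₁ k)) S
  below k = X-∷ w S (j<n k) ⇔-∘ X-∷ v (w ∷ S) (ℕ.m≤n⇒m≤1+n (j<n k))

  all : T (penultimate v) × T (hits σ S) → ∀ k → X (suc (suc n)) (j k) (v ∷ w ∷ S)
  all (p , h) k with view k
  ... | ‵fromℕ           = from top p
  ... | ‵inj₁ {i = i} _ = from (below i) (from (enc S) h i)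

Encodable : ℕ → Set
Encodable n = ∀ {r} (j : Fin r → ℕ) → (∀ k → 1 ≤ j k) → (∀ k → j k ℕ.< n) →
              StrictlyIncreasing j → Separated j → Σ[ σ ∈ Sparse n r ] Encodes σ j

-- Case distinction on whether the largest index is `suc n`, the one whose box lies in the top row.
-- If so, separation forces all others below `n` and two rows are removed; if not, one row is
-- removed.
encodable-2+ : Encodable n → Encodable (suc n) → Encodable (suc (suc n))
encodable-2+ {n} rec₀ rec₁ {zero} j lo hi inc sep =
  let σ , enc = rec₁ j lo (λ ()) inc sep in skip σ , skip-encodes (λ ()) enc
encodable-2+ {n} rec₀ rec₁ {suc r} j lo hi inc sep with j (Fin.fromℕ r) ℕ.≟ suc n
... | no j≢ = let σ , enc = rec₁ j lo hi′ inc sep in skip σ , skip-encodes hi′ enc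
  where
  hi′ : ∀ k → j k ℕ.< suc n
  hi′ k = ℕ.≤-<-trans (increasing⇒monotone inc (Fin.≤fromℕ k))
    (ℕ.≤∧≢⇒< (ℕ.≤-pred (hi (Fin.fromℕ r))) j≢)
... | yes j≡ =
  let σ , enc = rec₀ (j ∘ inject₁) (lo ∘ inject₁) hi′
        (λ k l k<l → inc (inject₁ k) (inject₁ l)
          (≡.subst₂ ℕ._<_ (≡.sym (Fin.toℕ-inject₁ k)) (≡.sym (Fin.toℕ-inject₁ l)) k<l))
        (λ k l eq → sep (inject₁ k) (inject₁ l)
          (≡.trans (Fin.toℕ-inject₁ l) (≡.trans eq (≡.cong suc (≡.sym (Fin.toℕ-inject₁ k))))))
  in take σ , take-encodes hi′ j≡ enc
  where
  open ℕ.≤-Reasoning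
  hi′ : ∀ k → j (inject₁ k) ℕ.< n
  hi′ k = ℕ.≤-pred (begin
    2 ℕ.+ j (inject₁ k)  ≡⟨ ℕ.+-comm 2 (j (inject₁ k)) ⟩
    j (inject₁ k) ℕ.+ 2  ≤⟨ sep (inject₁ k) (suc k) (≡.cong suc (≡.sym (Fin.toℕ-inject₁ k))) ⟩
    j (suc k)            ≤⟨ increasing⇒monotone inc (Fin.≤fromℕ (suc k)) ⟩
    j (Fin.fromℕ r)      ≡⟨ j≡ ⟩
    suc n                ∎)

-- Sizes 0 and 1 admit no index with `1 ≤ j k` and `j k < n`, so only the empty sequence occurs
-- there.
encodable : ∀ n → Encodable n
encodable zero {zero}  j lo hi inc sep = empty , λ S → mk⇔ _ λ _ ()
encodable zero {suc r} j lo hi inc sep = contradiction (hi zero) λ ()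
encodable (suc zero) {zero} j lo hi inc sep =
  skip empty , λ { (v ∷ []) → mk⇔ _ λ _ () }
encodable (suc zero) {suc r} j lo hi inc sep =
  contradiction (ℕ.<-≤-trans (hi zero) (lo zero)) (ℕ.<-irrefl ≡.refl)
encodable (suc (suc n)) = encodable-2+ (encodable n) (encodable (suc n))

-- Mutual exclusion of adjacent events.

-- The diagonal box right of the first and below the second box could contain neither symbol.
X-adjacent : ∀ {S : Filling n} {j} → suc j ℕ.< n → IsTableau S → X n j S → ¬ X n (suc j) S
X-adjacent {n} {S} {j} 1+j<n t ((i , k) , row≡ , col≡ , ne) (c , row≡′ , col≡′ , ne′) =
  go (S ! d) ≡.refl
  where
  1+j≤ : suc (toℕ k) ℕ.< n ∸ toℕ i
  1+j≤ = ℕ.+-cancelˡ-< (suc (toℕ i)) _ _ (begin-strict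
    suc (toℕ i) ℕ.+ suc (toℕ k)  ≡⟨ ≡.cong₂ ℕ._+_ row≡ col≡ ⟩
    n ∸ j ℕ.+ j                  ≡⟨ ℕ.m∸n+n≡m (ℕ.<⇒≤ (ℕ.<-trans (ℕ.n<1+n j) 1+j<n)) ⟩
    n                            <⟨ ℕ.n<1+n n ⟩
    suc n                        ≡⟨ ≡.cong suc (ℕ.m+[n∸m]≡n (ℕ.<⇒≤ (Fin.toℕ<n i))) ⟨
    suc (toℕ i) ℕ.+ (n ∸ toℕ i)  ∎)
    where open ℕ.≤-Reasoning
  d : Box n
  d = i , fromℕ< 1+j≤
  col-d : col d ≡ suc j
  col-d = ≡.cong suc (≡.trans (Fin.toℕ-fromℕ< 1+j≤) col≡)
  go : ∀ x → S ! d ≡ x → ⊥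
  go (just alpha) eq = ne′ (above-alpha t d c (≡.trans col≡′ (≡.sym col-d))
    (≡.subst₂ ℕ._<_ (≡.sym row≡′) (≡.sym row≡) (ℕ.∸-monoʳ-< (ℕ.n<1+n j) (ℕ.<⇒≤ 1+j<n))) eq)
  go (just beta)  eq = ne (left-beta t d (i , k) ≡.refl
    (≡.subst₂ ℕ._<_ (≡.sym col≡) (≡.sym col-d) (ℕ.n<1+n j)) eq)
  go nothing      eq = diagonal t d on eq
    where
    on : row d ℕ.+ col d ≡ n ℕ.+ 1
    on = begin
      row d ℕ.+ col d     ≡⟨ ≡.cong₂ ℕ._+_ row≡ col-d ⟩
      n ∸ j ℕ.+ suc j     ≡⟨ ≡.cong (n ∸ j ℕ.+_) (ℕ.+-comm 1 j) ⟩
      n ∸ j ℕ.+ (j ℕ.+ 1) ≡⟨ ℕ.+-assoc (n ∸ j) j 1 ⟨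
      n ∸ j ℕ.+ j ℕ.+ 1   ≡⟨ ≡.cong (ℕ._+ 1) (ℕ.m∸n+n≡m (ℕ.<⇒≤ (ℕ.<-trans (ℕ.n<1+n j) 1+j<n))) ⟩
      n ℕ.+ 1             ∎
      where open ≡.≡-Reasoning

-- A gap smaller than two between consecutive terms of a strictly increasing sequence is exactly
-- one, which `X-adjacent` excludes.
tableau⇒separated : ∀ {S : Filling n} {j : Fin r → ℕ} → (∀ k → j k ℕ.< n) → StrictlyIncreasing j →
                    IsTableau S → (∀ k → X n (j k) S) → Separated j
tableau⇒separated {n = n} {S = S} {j} hi inc t x k l l≡1+k with j k ℕ.+ 2 ℕ.≤? j l
... | yes p = p
... | no ¬p = contradiction (≡.subst (λ i → X n i S) jl≡ (x l))
  (X-adjacent (≡.subst (ℕ._< n) jl≡ (hi l)) t (x k))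
  where
  jl≡ : j l ≡ suc (j k)
  jl≡ = ℕ.≤-antisym
    (ℕ.≤-pred (≡.subst (j l ℕ.<_) (ℕ.+-comm (j k) 2) (ℕ.≰⇒> ¬p)))
    (inc k l (ℕ.≤-reflexive (≡.sym l≡1+k)))

-- Counts and finite sums over lists.

#free : Vec Bool n → ℕ
#free = countᵇ id

-- The size of the staircase left after removing a row and a column for each event.
reduced : Sparse n r → ℕ
reduced empty    = 0
reduced (skip σ) = suc (reduced σ)
reduced (take σ) = suc (reduced σ)

reduced+ : (σ : Sparse n r) → reduced σ ℕ.+ r ≡ n
reduced+ empty    = ≡.refl
reduced+ (skip σ) = ≡.cong suc (reduced+ σ)
reduced+ (take σ) = ≡.cong suc (≡.trans (ℕ.+-suc _ _) (≡.cong suc (reduced+ σ)))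

module ListSum {c ℓ} (R : CommutativeSemiring c ℓ) where
  open CommutativeSemiring R
  open import Relation.Binary.Reasoning.Setoid setoid
  open import Algebra.Properties.CommutativeSemigroup +-commutativeSemigroup using (interchange)

  -- Over an ordered field this unfolds to the same term as `sumᴸ` of a mapped list, so it applies
  -- directly to `ℙ` and `totalWeight`.
  ∑ : List A → (A → Carrier) → Carrier
  ∑ xs f = List.foldr _+_ 0# (List.map f xs)

  infixr 8 [_]·_
  -- The Iverson bracket of `b` as a coefficient.
  [_]·_ : Bool → Carrier → Carrier
  [ b ]· y = if b then y else 0#

  []·-cong : ∀ b {y z} → y ≈ z → [ b ]· y ≈ [ b ]· z
  []·-cong true  y≈z = y≈z
  []·-cong false _   = refl

  []·-* : ∀ b k y → [ b ]· (k * y) ≈ k * [ b ]· y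
  []·-* true  k y = refl
  []·-* false k y = sym (zeroʳ k)

  []·-∧ : ∀ a b y → [ a ∧ b ]· y ≈ [ b ]· [ a ]· y
  []·-∧ true  b     y = refl
  []·-∧ false true  y = refl
  []·-∧ false false y = refl

  ∑-cong : ∀ (xs : List A) {f g} → (∀ x → f x ≈ g x) → ∑ xs f ≈ ∑ xs g
  ∑-cong []       f≈g = refl
  ∑-cong (x ∷ xs) f≈g = +-cong (f≈g x) (∑-cong xs f≈g)

  ∑-zero : ∀ (xs : List A) → ∑ xs (λ _ → 0#) ≈ 0#
  ∑-zero []       = refl
  ∑-zero (x ∷ xs) = trans (+-identityˡ _) (∑-zero xs)

  ∑-+ : ∀ (xs : List A) f g → ∑ xs (λ x → f x + g x) ≈ ∑ xs f + ∑ xs g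
  ∑-+ []       f g = sym (+-identityˡ 0#)
  ∑-+ (x ∷ xs) f g = trans (+-congˡ (∑-+ xs f g)) (interchange _ _ _ _)

  ∑-* : ∀ (xs : List A) k f → ∑ xs (λ x → k * f x) ≈ k * ∑ xs f
  ∑-* []       k f = sym (zeroʳ k)
  ∑-* (x ∷ xs) k f = trans (+-congˡ (∑-* xs k f)) (sym (distribˡ k _ _))

  ∑-map-++ : ∀ (g : A → B) xs ys f → ∑ (List.map g xs ++ ys) f ≈ ∑ xs (f ∘ g) + ∑ ys f
  ∑-map-++ g []       ys f = sym (+-identityˡ _)
  ∑-map-++ g (x ∷ xs) ys f = trans (+-congˡ (∑-map-++ g xs ys f)) (sym (+-assoc _ _ _))

  ∑-product : ∀ (g : A → B → C) xs ys f →
              ∑ (List.cartesianProductWith g xs ys) f ≈ ∑ xs (λ x → ∑ ys (f ∘ g x))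
  ∑-product g []       ys f = refl
  ∑-product g (x ∷ xs) ys f =
    trans (∑-map-++ (g x) ys _ f) (+-congˡ (∑-product g xs ys f))

  ∑-swap : ∀ (xs : List A) (ys : List B) (f : A → B → Carrier) →
           ∑ xs (λ x → ∑ ys (f x)) ≈ ∑ ys (λ y → ∑ xs (λ x → f x y))
  ∑-swap []       ys f = sym (∑-zero ys)
  ∑-swap (x ∷ xs) ys f = trans (+-congˡ (∑-swap xs ys f)) (sym (∑-+ ys _ _))

  ∑-filter : ∀ {P : Pred A p} (P? : Decidable P) xs f →
             ∑ (List.filter P? xs) f ≈ ∑ xs (λ x → [ does (P? x) ]· f x)
  ∑-filter P? []       f = refl
  ∑-filter P? (x ∷ xs) f with does (P? x)
  ... | true  = +-congˡ (∑-filter P? xs f)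
  ... | false = trans (∑-filter P? xs f) (sym (+-identityˡ _))

-- Weighted sums over the valid rows above given columns.

module GeneratingFunction {c ℓ} (R : CommutativeSemiring c ℓ)
                          (α β : CommutativeSemiring.Carrier R) where
  open CommutativeSemiring R
  open ListSum R
  open import Relation.Binary.Reasoning.Setoid setoid
  open import Algebra.Definitions.RawSemiring rawSemiring using (_^_) renaming (_×_ to _·_)
  open import Algebra.Properties.Semiring.Exp semiring using (^-homo-*)
  open import Algebra.Solver.Ring.NaturalCoefficients.Default R
    using (solve; _:=_; _:+_; _:*_; con)

  weightʳ : Vec Cell n → Carrier
  weightʳ v = α ^ Vec.count (_≟ᶜ just alpha) v * β ^ Vec.count (_≟ᶜ just beta) v

  weight : Filling n → Carrier
  weight S = α ^ #[ alpha ] S * β ^ #[ beta ] S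

  weight-∷ : ∀ (v : Vec Cell (suc n)) S → weight (v ∷ S) ≈ weight S * weightʳ v
  weight-∷ v S = trans
    (*-cong (^-homo-* α (Vec.count (_≟ᶜ just alpha) v) (#[ alpha ] S))
            (^-homo-* β (Vec.count (_≟ᶜ just beta) v) (#[ beta ] S)))
    (solve 4 (λ a b c d → (a :* b) :* (c :* d) := (b :* d) :* (a :* c)) refl _ _ _ _)

  -- The weight of each symbol is absorbed into `g`, so the recursion runs along the columns and
  -- meets only the cells that `validRow` permits.
  rowSum : Bool → Vec Bool n → (Vec Cell (suc n) → Carrier) → Carrier
  rowSum false []           g = α * g (just alpha ∷ []) + β * g (just beta ∷ [])
  rowSum true  []           g = α * g (just alpha ∷ [])
  rowSum s     (false ∷ fs) g = rowSum s fs (g ∘ (nothing ∷_))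
  rowSum false (true ∷ fs)  g =
    rowSum false fs (g ∘ (nothing ∷_)) +
    (rowSum true fs (λ v → α * g (just alpha ∷ v)) +
     rowSum true fs (λ v → β * g (just beta ∷ v)))
  rowSum true  (true ∷ fs)  g =
    rowSum true fs (g ∘ (nothing ∷_)) + rowSum true fs (λ v → α * g (just alpha ∷ v))

  -- The sum is split by the first cell: a forbidden cell contributes zero, and the weight of a
  -- permitted one is moved over to `g`.
  ∑-rows : ∀ s (fs : Vec Bool n) g →
           ∑ (allVecs (suc n)) (λ v → [ validRow s v fs ]· (weightʳ v * g v)) ≈ rowSum s fs g
  ∑-rows {n} s fs g = trans (∑-product _∷_ cells (allVecs n) _) (by-first-cell s fs g)
    where
    α-out : ∀ a b g → ((α * a) * b) * g ≈ (a * b) * (α * g)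
    α-out = solve 4 (λ α a b g → ((α :* a) :* b) :* g := (a :* b) :* (α :* g)) refl α

    β-out : ∀ a b g → (a * (β * b)) * g ≈ (a * b) * (β * g)
    β-out = solve 4 (λ β a b g → (a :* (β :* b)) :* g := (a :* b) :* (β :* g)) refl β

    by-first-cell : ∀ {n} s (fs : Vec Bool n) g →
      ∑ cells (λ c → ∑ (allVecs n) (λ v →
        [ validRow s (c ∷ v) fs ]· (weightʳ (c ∷ v) * g (c ∷ v)))) ≈ rowSum s fs g
    -- The three groups are the cells empty, α and β in the diagonal box, each closed by the zero
    -- that ends its list; the empty cell is invalid and gives zero.
    by-first-cell false [] g = solve 4
      (λ α β g h →
        (con 0 :+ con 0) :+ (((((α :* con 1) :* con 1) :* g) :+ con 0) :+
          ((((con 1 :* (β :* con 1)) :* h) :+ con 0) :+ con 0))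
        := α :* g :+ β :* h) refl α β _ _
    by-first-cell true [] g = solve 2
      (λ α g →
        (con 0 :+ con 0) :+ (((((α :* con 1) :* con 1) :* g) :+ con 0) :+
          ((con 0 :+ con 0) :+ con 0))
        := α :* g) refl α _
    by-first-cell {suc n} false (false ∷ fs) g = trans (+-cong (∑-rows false fs _)
      (+-cong (∑-zero (allVecs (suc n))) (+-congʳ (∑-zero (allVecs (suc n))))))
      (solve 1 (λ a → a :+ (con 0 :+ (con 0 :+ con 0)) := a) refl _)
    by-first-cell {suc n} true (false ∷ fs) g = trans (+-cong (∑-rows true fs _)
      (+-cong (∑-zero (allVecs (suc n))) (+-congʳ (∑-zero (allVecs (suc n))))))
      (solve 1 (λ a → a :+ (con 0 :+ (con 0 :+ con 0)) := a) refl _)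
    by-first-cell {suc n} false (true ∷ fs) g = +-cong (∑-rows false fs _) (+-cong
      (trans (∑-cong (allVecs (suc n)) λ v → []·-cong (validRow true v fs) (α-out _ _ _))
        (∑-rows true fs _))
      (trans (+-identityʳ _)
        (trans (∑-cong (allVecs (suc n)) λ v → []·-cong (validRow true v fs) (β-out _ _ _))
          (∑-rows true fs _))))
    by-first-cell {suc n} true (true ∷ fs) g = +-cong (∑-rows true fs _) (trans (+-cong
      (trans (∑-cong (allVecs (suc n)) λ v → []·-cong (validRow true v fs) (α-out _ _ _))
        (∑-rows true fs _))
      (trans (+-identityʳ _) (∑-zero (allVecs (suc n))))) (+-identityʳ _))

  rowSum-cong : ∀ s (fs : Vec Bool n) {g h} → (∀ v → g v ≈ h v) → rowSum s fs g ≈ rowSum s fs h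
  rowSum-cong false []           g≈h = +-cong (*-congˡ (g≈h _)) (*-congˡ (g≈h _))
  rowSum-cong true  []           g≈h = *-congˡ (g≈h _)
  rowSum-cong false (false ∷ fs) g≈h = rowSum-cong false fs λ v → g≈h (nothing ∷ v)
  rowSum-cong true  (false ∷ fs) g≈h = rowSum-cong true fs λ v → g≈h (nothing ∷ v)
  rowSum-cong false (true ∷ fs)  g≈h = +-cong (rowSum-cong false fs λ v → g≈h (nothing ∷ v))
    (+-cong (rowSum-cong true fs λ v → *-congˡ (g≈h (just alpha ∷ v)))
            (rowSum-cong true fs λ v → *-congˡ (g≈h (just beta ∷ v))))
  rowSum-cong true  (true ∷ fs)  g≈h = +-cong (rowSum-cong true fs λ v → g≈h (nothing ∷ v))
    (rowSum-cong true fs λ v → *-congˡ (g≈h (just alpha ∷ v)))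

  -- Linearity is clear for the explicit sum over rows and is carried over by `∑-rows`.
  rowSum-linear : ∀ s (fs : Vec Bool n) k l g h →
    rowSum s fs (λ v → k * g v + l * h v) ≈ k * rowSum s fs g + l * rowSum s fs h
  rowSum-linear {n} s fs k l g h = begin
    rowSum s fs (λ v → k * g v + l * h v)
      ≈⟨ ∑-rows s fs _ ⟨
    ∑ (allVecs (suc n)) (λ v → [ validRow s v fs ]· (weightʳ v * (k * g v + l * h v)))
      ≈⟨ ∑-cong (allVecs (suc n)) (λ v → distribute (validRow s v fs) (weightʳ v) (g v) (h v)) ⟩
    ∑ (allVecs (suc n)) (λ v → k * [ validRow s v fs ]· (weightʳ v * g v) +
                         l * [ validRow s v fs ]· (weightʳ v * h v))
      ≈⟨ ∑-+ (allVecs (suc n)) _ _ ⟩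
    ∑ (allVecs (suc n)) (λ v → k * [ validRow s v fs ]· (weightʳ v * g v)) +
    ∑ (allVecs (suc n)) (λ v → l * [ validRow s v fs ]· (weightʳ v * h v))
      ≈⟨ +-cong (∑-* (allVecs (suc n)) k _) (∑-* (allVecs (suc n)) l _) ⟩
    k * ∑ (allVecs (suc n)) (λ v → [ validRow s v fs ]· (weightʳ v * g v)) +
    l * ∑ (allVecs (suc n)) (λ v → [ validRow s v fs ]· (weightʳ v * h v))
      ≈⟨ +-cong (*-congˡ (∑-rows s fs g)) (*-congˡ (∑-rows s fs h)) ⟩
    k * rowSum s fs g + l * rowSum s fs h ∎
    where
    distribute : ∀ b w y z →
      [ b ]· (w * (k * y + l * z)) ≈ k * [ b ]· (w * y) + l * [ b ]· (w * z)
    distribute true  w y z = solve 5 (λ w k l y z →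
      w :* (k :* y :+ l :* z) := k :* (w :* y) :+ l :* (w :* z)) refl w k l y z
    distribute false w y z = solve 2 (λ k l → con 0 := k :* con 0 :+ l :* con 0) refl k l

  rowSum-* : ∀ s (fs : Vec Bool n) k g → rowSum s fs (λ v → k * g v) ≈ k * rowSum s fs g
  rowSum-* s fs k g = begin
    rowSum s fs (λ v → k * g v)
      ≈⟨ rowSum-cong s fs (λ v → solve 2 (λ k g → k :* g := k :* g :+ con 0 :* g) refl k (g v)) ⟩
    rowSum s fs (λ v → k * g v + 0# * g v)
      ≈⟨ rowSum-linear s fs k 0# g g ⟩
    k * rowSum s fs g + 0# * rowSum s fs g
      ≈⟨ solve 2 (λ k g → k :* g :+ con 0 :* g := k :* g) refl k (rowSum s fs g) ⟩
    k * rowSum s fs g ∎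

  rowSum-[]· : ∀ s (fs : Vec Bool n) b g → rowSum s fs (λ v → [ b ]· g v) ≈ [ b ]· rowSum s fs g
  rowSum-[]· s fs true  g = refl
  rowSum-[]· s fs false g = begin
    rowSum s fs (λ _ → 0#)      ≈⟨ rowSum-cong s fs (λ _ → zeroˡ 0#) ⟨
    rowSum s fs (λ _ → 0# * 0#) ≈⟨ rowSum-* s fs 0# (λ _ → 0#) ⟩
    0# * rowSum s fs (λ _ → 0#) ≈⟨ zeroˡ _ ⟩
    0#                          ∎

  -- Weighted sums over all tableaux of a given size.

  opaque
    -- Opaque, so that outside this block the sum is rewritten only through the lemmas below and the
    -- enumeration of fillings stays folded.
    fillSum : (Filling n → Carrier) → Carrier
    fillSum {n} h = ∑ (allFillings n) (λ S → [ valid S ]· (weight S * h S))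

    fillSum-[] : ∀ h → fillSum h ≈ h []
    fillSum-[] h = solve 1 (λ h → (con 1 :* con 1) :* h :+ con 0 := h) refl (h [])

    fillSum-tableaux : ∀ h → ∑ (tableaux n) (λ S → weight S * h S) ≈ fillSum h
    fillSum-tableaux {n} h = trans (∑-filter isTableau? (allFillings n) _)
      (∑-cong (allFillings n) λ S → reflexive
        (≡.cong ([_]· (weight S * h S)) (does-⇔ (IsTableau⇔valid S) (isTableau? S) (T? (valid S)))))

    fillSum-cong : ∀ {g h : Filling n → Carrier} → (∀ S → g S ≈ h S) → fillSum g ≈ fillSum h
    fillSum-cong {n} g≈h =
      ∑-cong (allFillings n) λ S → []·-cong (valid S) (*-congˡ (g≈h S))

    fillSum-* : ∀ k (h : Filling n → Carrier) → fillSum (λ S → k * h S) ≈ k * fillSum h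
    fillSum-* {n} k h = trans
      (∑-cong (allFillings n) λ S → trans
        ([]·-cong (valid S)
          (solve 3 (λ w k h → w :* (k :* h) := k :* (w :* h)) refl (weight S) k (h S)))
        ([]·-* (valid S) k _))
      (∑-* (allFillings n) k _)

    -- The order of summation is exchanged to make the lower tableau the outer variable, since the
    -- admissible top rows depend on its free columns.
    fillSum-∷ : ∀ (h : Filling (suc n) → Carrier) →
                fillSum h ≈ fillSum (λ S → rowSum false (αFree S) (λ v → h (v ∷ S)))
    fillSum-∷ {n} h = begin
      fillSum h
        ≈⟨ ∑-product _∷_ (allVecs (suc n)) (allFillings n) _ ⟩
      ∑ (allVecs (suc n)) (λ v → ∑ (allFillings n) (λ S →
        [ validRow false v (αFree S) ∧ valid S ]· (weight (v ∷ S) * h (v ∷ S))))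
        ≈⟨ ∑-swap (allVecs (suc n)) (allFillings n) _ ⟩
      ∑ (allFillings n) (λ S → ∑ (allVecs (suc n)) (λ v →
        [ validRow false v (αFree S) ∧ valid S ]· (weight (v ∷ S) * h (v ∷ S))))
        ≈⟨ ∑-cong (allFillings n) (λ S → trans
             (∑-cong (allVecs (suc n)) λ v → split v S (validRow false v (αFree S)))
             (factor S (valid S))) ⟩
      fillSum (λ S → rowSum false (αFree S) (λ v → h (v ∷ S))) ∎
      where
      split : ∀ v S b → [ b ∧ valid S ]· (weight (v ∷ S) * h (v ∷ S)) ≈
              [ valid S ]· (weight S * [ b ]· (weightʳ v * h (v ∷ S)))
      split v S b = begin
        [ b ∧ valid S ]· (weight (v ∷ S) * h (v ∷ S))
          ≈⟨ []·-∧ b (valid S) _ ⟩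
        [ valid S ]· [ b ]· (weight (v ∷ S) * h (v ∷ S))
          ≈⟨ []·-cong (valid S) ([]·-cong b (trans (*-congʳ (weight-∷ v S)) (*-assoc _ _ _))) ⟩
        [ valid S ]· [ b ]· (weight S * (weightʳ v * h (v ∷ S)))
          ≈⟨ []·-cong (valid S) ([]·-* b (weight S) _) ⟩
        [ valid S ]· (weight S * [ b ]· (weightʳ v * h (v ∷ S))) ∎

      factor : ∀ S b →
        ∑ (allVecs (suc n)) (λ v →
          [ b ]· (weight S * [ validRow false v (αFree S) ]· (weightʳ v * h (v ∷ S)))) ≈
        [ b ]· (weight S * rowSum false (αFree S) (λ v → h (v ∷ S)))
      factor S true  = trans (∑-* (allVecs (suc n)) (weight S) _)
                             (*-congˡ (∑-rows false (αFree S) _))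
      factor S false = ∑-zero (allVecs (suc n))

  -- Row sums in which `x` marks the free columns.

  module _ (x : Carrier) where

    freeSum : (Vec Cell (suc n) → Bool) → Bool → Vec Bool n → Carrier
    freeSum p s fs = rowSum s fs (λ v → [ p v ]· (x ^ #free (extendFree v fs)))

    -- The contribution of the first symbol of a row.
    entry : Bool → Carrier
    entry false = α + β * x
    entry true  = α

    rows : Bool → Vec Bool n → Carrier
    rows = freeSum (λ _ → true)

    rows′ : Bool → Vec Bool (suc n) → Carrier
    rows′ = freeSum penultimate

    -- An open first column left empty stays free and gives `x`. A symbol there gives `entry s`, β
    -- keeping the column free and α blocking it, and sets the flag. The condition on `q` says that
    -- it ignores the first cell.
    freeSum-true : ∀ (p : Vec Cell (suc n) → Bool) (q : Vec Cell (suc (suc n)) → Bool) →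
      (∀ c v → q (c ∷ v) ≡ p v) → ∀ s fs →
      freeSum q s (true ∷ fs) ≈ x * freeSum p s fs + entry s * freeSum p true fs
    freeSum-true p q q≡p s fs = go s
      where
      e : Vec Cell (suc _) → Carrier
      e v = x ^ #free (extendFree v fs)
      pull : ∀ k s → ∀ {y} → (∀ v → y v ≈ k * [ p v ]· e v) → rowSum s fs y ≈ k * freeSum p s fs
      pull k s eq = trans (rowSum-cong s fs eq) (rowSum-* s fs k _)
      nothing-step : ∀ v → [ q (nothing ∷ v) ]· (x * e v) ≈ x * [ p v ]· e v
      nothing-step v rewrite q≡p nothing v = []·-* (p v) x (e v)
      alpha-step : ∀ v → α * [ q (just alpha ∷ v) ]· e v ≈ α * [ p v ]· e v
      alpha-step v rewrite q≡p (just alpha) v = refl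
      beta-step : ∀ v → β * [ q (just beta ∷ v) ]· (x * e v) ≈ (β * x) * [ p v ]· e v
      beta-step v rewrite q≡p (just beta) v =
        trans (*-congˡ ([]·-* (p v) x (e v))) (sym (*-assoc β x _))
      go : ∀ s → freeSum q s (true ∷ fs) ≈ x * freeSum p s fs + entry s * freeSum p true fs
      go false = +-cong (pull x false nothing-step)
        (trans (+-cong (pull α true alpha-step) (pull (β * x) true beta-step))
          (sym (distribʳ _ α (β * x))))
      go true = +-cong (pull x true nothing-step) (pull α true alpha-step)

    -- By induction, each open column contributes `x` when empty or `α`, and the first symbol
    -- accounts for `entry s`. A blocked column stays empty and blocked, so it gives no factor.
    rows-≈ : ∀ s (fs : Vec Bool n) → rows s fs ≈ entry s * (x + α) ^ #free fs
    rows-≈ false [] = solve 3 (λ α β x →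
      α :* con 1 :+ β :* (x :* con 1) := (α :+ β :* x) :* con 1) refl α β x
    rows-≈ true  [] = refl
    rows-≈ false (false ∷ fs) = rows-≈ false fs
    rows-≈ true  (false ∷ fs) = rows-≈ true fs
    rows-≈ s (true ∷ fs) = trans (freeSum-true (λ _ → true) (λ _ → true) (λ _ _ → ≡.refl) s fs)
      (trans (+-cong (*-congˡ (rows-≈ s fs)) (*-congˡ (rows-≈ true fs)))
        (solve 4 (λ x e α p → x :* (e :* p) :+ e :* (α :* p) := e :* ((x :+ α) :* p))
          refl x (entry s) α ((x + α) ^ #free fs)))

    rows′-true : ∀ s (fs : Vec Bool (suc n)) →
      rows′ s (true ∷ fs) ≈ x * rows′ s fs + entry s * rows′ true fs
    rows′-true = freeSum-true penultimate penultimate (λ _ _ → ≡.refl)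

    rows′-false : ∀ s (fs : Vec Bool (suc n)) → rows′ s (false ∷ fs) ≈ rows′ s fs
    rows′-false false fs = refl
    rows′-false true  fs = refl

    rows′-closed : ∀ s → rows′ s (false ∷ []) ≈ 0#
    rows′-closed false = solve 2 (λ α β → α :* con 0 :+ β :* con 0 := con 0) refl α β
    rows′-closed true  = zeroʳ α

    -- The penultimate box must hold a symbol, so the diagonal box to its right can only hold α.
    -- Apart from this α, the penultimate box behaves like the single box of `rows s []`.
    rows′-open : ∀ s → rows′ s (true ∷ []) ≈ α * rows s []
    rows′-open false = solve 3 (λ α β x →
      (α :* con 0 :+ β :* con 0) :+ (α :* (α :* con 1) :+ α :* (β :* (x :* con 1)))
      := α :* (α :* con 1 :+ β :* (x :* con 1))) refl α β x
    rows′-open true = solve 1 (λ α →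
      α :* con 0 :+ α :* (α :* con 1) := α :* (α :* con 1)) refl α

    -- `w` is the lower row with flag `s`; the row above it has flag `t` and a non-empty penultimate
    -- box.
    twoRows : Bool → Bool → Vec Bool n → Carrier
    twoRows s t fs = rowSum s fs (λ w → rows′ t (extendFree w fs))

    twoRows-true∷ : ∀ s t (fs : Vec Bool n) →
      rowSum s fs (λ w → rows′ t (true ∷ extendFree w fs)) ≈
      x * twoRows s t fs + entry t * twoRows s true fs
    twoRows-true∷ s t fs = trans (rowSum-cong s fs λ w → rows′-true t (extendFree w fs))
      (rowSum-linear s fs x (entry t) _ _)

    twoRows-false∷ : ∀ s t k (fs : Vec Bool n) →
      rowSum s fs (λ w → k * rows′ t (false ∷ extendFree w fs)) ≈ k * twoRows s t fs
    twoRows-false∷ s t k fs = trans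
      (rowSum-cong s fs λ w → *-congˡ (rows′-false t (extendFree w fs)))
      (rowSum-* s fs k _)

    -- A lower row that starts before its diagonal box ends with α, which blocks the
    -- penultimate box above.
    twoRows-seen : ∀ t (fs : Vec Bool n) → twoRows true t fs ≈ 0#
    twoRows-seen t []           = trans (*-congˡ (rows′-closed t)) (zeroʳ α)
    twoRows-seen t (false ∷ fs) = trans
      (rowSum-cong true fs λ w → rows′-false t (extendFree w fs)) (twoRows-seen t fs)
    twoRows-seen t (true ∷ fs)  = begin
      rowSum true fs (λ w → rows′ t (true ∷ extendFree w fs)) +
      rowSum true fs (λ w → α * rows′ t (false ∷ extendFree w fs))
        ≈⟨ +-cong (twoRows-true∷ true t fs) (twoRows-false∷ true t α fs) ⟩
      (x * twoRows true t fs + entry t * twoRows true true fs) + α * twoRows true t fs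
        ≈⟨ +-cong (+-cong (*-congˡ (twoRows-seen t fs)) (*-congˡ (twoRows-seen true fs)))
                  (*-congˡ (twoRows-seen t fs)) ⟩
      (x * 0# + entry t * 0#) + α * 0#
        ≈⟨ solve 3 (λ x e α → (x :* con 0 :+ e :* con 0) :+ α :* con 0 := con 0)
             refl x (entry t) α ⟩
      0# ∎

    -- By `twoRows-seen` a symbol of the lower row before its diagonal box gives zero. The lower row
    -- is therefore a single β, the upper row ends in α, and what remains of the upper row obeys the
    -- recursion of `rows` over `fs`.
    twoRows-≈ : ∀ t (fs : Vec Bool n) → twoRows false t fs ≈ (α * β) * rows t fs
    twoRows-≈ t [] = begin
      α * rows′ t (false ∷ []) + β * rows′ t (true ∷ [])
        ≈⟨ +-cong (*-congˡ (rows′-closed t)) (*-congˡ (rows′-open t)) ⟩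
      α * 0# + β * (α * rows t [])
        ≈⟨ solve 3 (λ α β r → α :* con 0 :+ β :* (α :* r) := (α :* β) :* r)
             refl α β (rows t []) ⟩
      (α * β) * rows t [] ∎
    twoRows-≈ false (false ∷ fs) = twoRows-≈ false fs
    twoRows-≈ true  (false ∷ fs) = twoRows-≈ true fs
    twoRows-≈ t (true ∷ fs) = begin
      rowSum false fs (λ w → rows′ t (true ∷ extendFree w fs)) +
      (rowSum true fs (λ w → α * rows′ t (false ∷ extendFree w fs)) +
       rowSum true fs (λ w → β * rows′ t (true ∷ extendFree w fs)))
        ≈⟨ +-cong (twoRows-true∷ false t fs) (+-cong (twoRows-false∷ true t α fs)
             (trans (rowSum-* true fs β _) (*-congˡ (twoRows-true∷ true t fs)))) ⟩
      (x * twoRows false t fs + entry t * twoRows false true fs) +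
      (α * twoRows true t fs + β * (x * twoRows true t fs + entry t * twoRows true true fs))
        ≈⟨ +-cong (+-cong (*-congˡ (twoRows-≈ t fs)) (*-congˡ (twoRows-≈ true fs)))
             (+-cong (*-congˡ (twoRows-seen t fs)) (*-congˡ
               (+-cong (*-congˡ (twoRows-seen t fs)) (*-congˡ (twoRows-seen true fs))))) ⟩
      (x * ((α * β) * rows t fs) + entry t * ((α * β) * rows true fs)) +
      (α * 0# + β * (x * 0# + entry t * 0#))
        ≈⟨ solve 6 (λ α β x e p q →
             (x :* ((α :* β) :* p) :+ e :* ((α :* β) :* q)) :+
             (α :* con 0 :+ β :* (x :* con 0 :+ e :* con 0))
             := (α :* β) :* (x :* p :+ e :* q))
             refl α β x (entry t) (rows t fs) (rows true fs) ⟩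
      (α * β) * (x * rows t fs + entry t * rows true fs)
        ≈⟨ *-congˡ (freeSum-true (λ _ → true) (λ _ → true) (λ _ _ → ≡.refl) t fs) ⟨
      (α * β) * rows t (true ∷ fs) ∎

  -- Closed form for the weight of the tableaux in separated events.

  -- This is `D n x` of the introduction, the product of `α + β * (x + i · α)` over `i < n`.
  Z : ℕ → Carrier → Carrier
  Z zero    x = 1#
  Z (suc n) x = (α + β * x) * Z n (x + α)

  -- Splits off the last factor instead of the first, so that `x` stays fixed and values at `x = 1`
  -- can be compared for different sizes.
  Z-snoc : ∀ n x → Z (suc n) x ≈ (α + β * (x + n · α)) * Z n x
  Z-snoc zero    x = solve 3 (λ α β x →
    (α :+ β :* x) :* con 1 := (α :+ β :* (x :+ con 0)) :* con 1) refl α β x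
  Z-snoc (suc n) x = trans (*-congˡ (Z-snoc n (x + α)))
    (solve 5 (λ α β x m z →
      (α :+ β :* x) :* ((α :+ β :* ((x :+ α) :+ m)) :* z)
      := (α :+ β :* (x :+ (α :+ m))) :* ((α :+ β :* x) :* z))
      refl α β x (n · α) (Z n (x + α)))

  eventSum : Sparse n r → Carrier → Carrier
  eventSum σ x = fillSum (λ S → [ hits σ S ]· (x ^ #free (αFree S)))

  eventSum-skip : ∀ (σ : Sparse n r) x →
    eventSum (skip σ) x ≈ (α + β * x) * eventSum σ (x + α)
  eventSum-skip σ x = begin
    eventSum (skip σ) x
      ≈⟨ fillSum-∷ _ ⟩
    fillSum (λ S → rowSum false (αFree S) (λ v →
      [ hits σ S ]· (x ^ #free (extendFree v (αFree S)))))
      ≈⟨ fillSum-cong (λ S → trans (rowSum-[]· false (αFree S) (hits σ S) _)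
           (trans ([]·-cong (hits σ S) (rows-≈ x false (αFree S))) ([]·-* (hits σ S) _ _))) ⟩
    fillSum (λ S → (α + β * x) * [ hits σ S ]· ((x + α) ^ #free (αFree S)))
      ≈⟨ fillSum-* (α + β * x) _ ⟩
    (α + β * x) * eventSum σ (x + α) ∎

  -- The two top rows together act as one unrestricted row with the extra factor `α * β`.
  eventSum-take : ∀ (σ : Sparse n r) x →
    eventSum (take σ) x ≈ (α * β) * ((α + β * x) * eventSum σ (x + α))
  eventSum-take σ x = begin
    eventSum (take σ) x
      ≈⟨ fillSum-∷ _ ⟩
    fillSum (λ S → rowSum false (αFree S) (λ v →
      [ hits (take σ) (v ∷ S) ]· (x ^ #free (αFree (v ∷ S)))))
      ≈⟨ fillSum-∷ _ ⟩
    fillSum (λ S → rowSum false (αFree S) (λ w → rowSum false (αFree (w ∷ S)) (λ v →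
      [ penultimate v ∧ hits σ S ]· (x ^ #free (αFree (v ∷ w ∷ S))))))
      ≈⟨ fillSum-cong two ⟩
    fillSum (λ S → ((α * β) * (α + β * x)) * [ hits σ S ]· ((x + α) ^ #free (αFree S)))
      ≈⟨ fillSum-* _ _ ⟩
    ((α * β) * (α + β * x)) * eventSum σ (x + α)
      ≈⟨ *-assoc _ _ _ ⟩
    (α * β) * ((α + β * x) * eventSum σ (x + α)) ∎
    where
    two : ∀ S → rowSum false (αFree S) (λ w → rowSum false (αFree (w ∷ S)) (λ v →
      [ penultimate v ∧ hits σ S ]· (x ^ #free (αFree (v ∷ w ∷ S))))) ≈
      ((α * β) * (α + β * x)) * [ hits σ S ]· ((x + α) ^ #free (αFree S))
    two S = begin
      -- `hits σ S` involves neither of the two new rows, so its bracket leaves both row sums.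
      _ ≈⟨ rowSum-cong false (αFree S) (λ w → trans
             (rowSum-cong false (αFree (w ∷ S)) λ v → []·-∧ (penultimate v) (hits σ S) _)
             (rowSum-[]· false (αFree (w ∷ S)) (hits σ S) _)) ⟩
      rowSum false (αFree S) (λ w → [ hits σ S ]· rows′ x false (αFree (w ∷ S)))
        ≈⟨ rowSum-[]· false (αFree S) (hits σ S) _ ⟩
      [ hits σ S ]· twoRows x false false (αFree S)
        ≈⟨ []·-cong (hits σ S) (trans (twoRows-≈ x false (αFree S))
             (trans (*-congˡ (rows-≈ x false (αFree S))) (sym (*-assoc _ _ _)))) ⟩
      [ hits σ S ]· (((α * β) * (α + β * x)) * (x + α) ^ #free (αFree S))
        ≈⟨ []·-* (hits σ S) _ _ ⟩
      ((α * β) * (α + β * x)) * [ hits σ S ]· ((x + α) ^ #free (αFree S)) ∎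

  eventSum-≈ : ∀ (σ : Sparse n r) x → eventSum σ x ≈ (α * β) ^ r * Z (reduced σ) x
  eventSum-≈ empty x = trans (fillSum-[] _) (sym (*-identityˡ 1#))
  eventSum-≈ (skip σ) x = trans (eventSum-skip σ x) (trans (*-congˡ (eventSum-≈ σ (x + α)))
    (solve 3 (λ e p z → e :* (p :* z) := p :* (e :* z)) refl _ _ _))
  eventSum-≈ (take σ) x = trans (eventSum-take σ x)
    (trans (*-congˡ (*-congˡ (eventSum-≈ σ (x + α))))
      (solve 4 (λ q e p z → q :* (e :* (p :* z)) := (q :* p) :* (e :* z)) refl _ _ _ _))

  1^ : ∀ k → 1# ^ k ≈ 1#
  1^ zero    = refl
  1^ (suc k) = trans (*-identityˡ _) (1^ k)

  -- Setting `x = 1` forgets the number of free columns and leaves the plain weight.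
  ∑-events : ∀ {Q : Pred (Filling n) p} (Q? : Decidable Q) (σ : Sparse n r) →
    (∀ S → Q S ⇔ T (hits σ S)) →
    ∑ (List.filter Q? (tableaux n)) weight ≈ (α * β) ^ r * Z (reduced σ) 1#
  ∑-events {n} {r = r} Q? σ enc = begin
    ∑ (List.filter Q? (tableaux n)) weight
      ≈⟨ ∑-filter Q? (tableaux n) weight ⟩
    ∑ (tableaux n) (λ S → [ does (Q? S) ]· weight S)
      ≈⟨ ∑-cong (tableaux n) summand ⟩
    ∑ (tableaux n) (λ S → weight S * [ hits σ S ]· (1# ^ #free (αFree S)))
      ≈⟨ fillSum-tableaux _ ⟩
    eventSum σ 1#
      ≈⟨ eventSum-≈ σ 1# ⟩
    (α * β) ^ r * Z (reduced σ) 1# ∎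
    where
    summand : ∀ S → [ does (Q? S) ]· weight S ≈ weight S * [ hits σ S ]· (1# ^ #free (αFree S))
    summand S = begin
      [ does (Q? S) ]· weight S
        ≡⟨ ≡.cong ([_]· weight S) (does-⇔ (enc S) (Q? S) (T? (hits σ S))) ⟩
      [ hits σ S ]· weight S
        ≈⟨ []·-cong (hits σ S) (trans (*-congˡ (1^ (#free (αFree S)))) (*-identityʳ _)) ⟨
      [ hits σ S ]· (weight S * 1# ^ #free (αFree S))
        ≈⟨ []·-* (hits σ S) (weight S) _ ⟩
      weight S * [ hits σ S ]· (1# ^ #free (αFree S)) ∎

  -- The total weight is the case of no events: the empty index sequence has an encoding with
  -- `r = 0`, hence `reduced σ = n`.
  ∑-tableaux : ∀ n → ∑ (tableaux n) weight ≈ Z n 1#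
  ∑-tableaux n = let σ , enc = encodable n j (λ ()) (λ ()) (λ ()) (λ ()) in begin
    ∑ (tableaux n) weight
      ≡⟨ ≡.cong (λ xs → ∑ xs weight)
           (List.filter-all none? (All.universal (λ _ ()) (tableaux n))) ⟨
    ∑ (List.filter none? (tableaux n)) weight
      ≈⟨ ∑-events none? σ enc ⟩
    1# * Z (reduced σ) 1#
      ≈⟨ *-identityˡ _ ⟩
    Z (reduced σ) 1#
      ≡⟨ ≡.cong (λ m → Z m 1#) (≡.trans (≡.sym (ℕ.+-identityʳ _)) (reduced+ σ)) ⟩
    Z n 1# ∎
    where
    j : Fin 0 → ℕ
    j ()
    none? : Decidable (λ S → ∀ k → X n (j k) S)
    none? S = Fin.all? λ ()

-- Passage from weights to probabilities.

module Field {c ℓ₁ ℓ₂ ℓ₃} (F : OrderedField c ℓ₁ ℓ₂ ℓ₃) where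
  open OrderedField F
  open Probability F
  open CommutativeRing commutativeRing using (commutativeSemiring; *-commutativeMonoid)
  open import Relation.Binary.Reasoning.Setoid setoid
  open import Algebra.Properties.Semiring.Mult semiring using (×-homo-+; ×-assoc-*; ×-congʳ)
  open import Algebra.Properties.CommutativeMonoid.Sum *-commutativeMonoid
    using () renaming (sum-cong-≋ to ∏-cong; ∑-distrib-+ to ∏-*; sum-replicate-zero to ∏-1)
  open import Algebra.Solver.Ring.NaturalCoefficients.Default commutativeSemiring
    using (solve; _:=_; _:+_; _:*_; con)
  open GroupProperties +-group using (//-rightDividesʳ)
  open ListSum commutativeSemiring

  -- Under `r ≤ n` the subtractions cancel, and the order `i + (n ∸ r)` matches the factors in
  -- `Z-+`.
  denominator≈ : ∀ {n r} a b i → r ≤ n →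
    fromℕ n + a + b - fromℕ r + fromℕ (suc i) - 1# ≈ fromℕ (i ℕ.+ (n ∸ r)) + (a + b)
  denominator≈ {n} {r} a b i r≤n = begin
    fromℕ n + a + b - fromℕ r + (1# + I) - 1#
      ≡⟨ ≡.cong (λ m → fromℕ m + a + b - fromℕ r + (1# + I) - 1#) (≡.sym (ℕ.m∸n+n≡m r≤n)) ⟩
    fromℕ (n ∸ r ℕ.+ r) + a + b - fromℕ r + (1# + I) - 1#
      ≈⟨ +-congʳ (+-congʳ (+-congʳ (trans (+-congʳ (+-congʳ (×-homo-+ 1# (n ∸ r) r)))
           (solve 4 (λ m r a b → ((m :+ r) :+ a) :+ b := (m :+ (a :+ b)) :+ r)
             ≈-refl M (fromℕ r) a b)))) ⟩
    M + (a + b) + fromℕ r - fromℕ r + (1# + I) - 1#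
      ≈⟨ +-congʳ (+-congʳ (//-rightDividesʳ (fromℕ r) _)) ⟩
    M + (a + b) + (1# + I) - 1#
      ≈⟨ +-congʳ (solve 3 (λ m s i → (m :+ s) :+ (con 1 :+ i) := ((i :+ m) :+ s) :+ con 1)
           ≈-refl M (a + b) I) ⟩
    I + M + (a + b) + 1# - 1#
      ≈⟨ //-rightDividesʳ 1# _ ⟩
    I + M + (a + b)
      ≈⟨ +-congʳ (×-homo-+ 1# i (n ∸ r)) ⟨
    fromℕ (i ℕ.+ (n ∸ r)) + (a + b) ∎
    where
    M = fromℕ (n ∸ r)
    I = fromℕ i

  ∏-inverse : ∀ {r} (d e : Fin r → Carrier) → (∀ k → d k * e k ≈ 1#) → ∏ d * ∏ e ≈ 1#
  ∏-inverse {r} d e de≈1 =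
    trans (sym (∏-* d e)) (trans (∏-cong de≈1) (∏-1 r))

  module _ {α β a b : Carrier} (α*a≈1 : α * a ≈ 1#) (β*b≈1 : β * b ≈ 1#) where
    open GeneratingFunction commutativeSemiring α β

    -- Writing `α` as `α * β * b` and `β` as `α * β * a` brings out the factor `α * β` and leaves
    -- `p + a + b`.
    Z-suc : ∀ p → Z (suc p) 1# ≈ (α * β) * (fromℕ p + (a + b)) * Z p 1#
    Z-suc p = trans (Z-snoc p 1#) (*-congʳ (begin
      α + β * (1# + p · α)
        ≈⟨ +-congˡ (*-congˡ (+-congˡ p·α≈)) ⟩
      α + β * (1# + fromℕ p * α)
        ≈⟨ solve 3 (λ α β p → α :+ β :* (con 1 :+ p :* α) :=
             α :* con 1 :+ (β :* con 1 :+ α :* β :* p)) ≈-refl α β (fromℕ p) ⟩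
      α * 1# + (β * 1# + α * β * fromℕ p)
        ≈⟨ +-cong (*-congˡ β*b≈1) (+-congʳ (*-congˡ α*a≈1)) ⟨
      α * (β * b) + (β * (α * a) + α * β * fromℕ p)
        ≈⟨ solve 5 (λ α β a b p → α :* (β :* b) :+ (β :* (α :* a) :+ α :* β :* p) :=
             (α :* β) :* (p :+ (a :+ b))) ≈-refl α β a b (fromℕ p) ⟩
      (α * β) * (fromℕ p + (a + b)) ∎))
      where
      p·α≈ : p · α ≈ fromℕ p * α
      p·α≈ = sym (trans (×-assoc-* p 1# α) (×-congʳ p (*-identityˡ α)))

    -- The quotient of the total weight by the weight of `r` separated events. The factor with the
    -- smallest index is split off first, since it is the head of the product.
    Z-+ : ∀ r p → Z (r ℕ.+ p) 1# ≈
          ((α * β) ^ r * Z p 1#) * ∏ {r} (λ k → fromℕ (toℕ k ℕ.+ p) + (a + b))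
    Z-+ zero    p = solve 1 (λ z → z := (con 1 :* z) :* con 1) ≈-refl (Z p 1#)
    Z-+ (suc r) p = begin
      Z (suc r ℕ.+ p) 1#
        ≡⟨ ≡.cong (λ m → Z m 1#) (ℕ.+-suc r p) ⟨
      Z (r ℕ.+ suc p) 1#
        ≈⟨ Z-+ r (suc p) ⟩
      ((α * β) ^ r * Z (suc p) 1#) * ∏ {r} (λ k → fromℕ (toℕ k ℕ.+ suc p) + (a + b))
        ≈⟨ *-cong (*-congˡ (Z-suc p)) (∏-cong {r} λ k →
             reflexive (≡.cong (λ m → fromℕ m + (a + b)) (ℕ.+-suc (toℕ k) p))) ⟩
      ((α * β) ^ r * ((α * β) * D * Z p 1#)) * P
        ≈⟨ solve 5 (λ q x d z y → (x :* ((q :* d) :* z)) :* y := ((q :* x) :* z) :* (d :* y))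
             ≈-refl (α * β) ((α * β) ^ r) D (Z p 1#) P ⟩
      ((α * β) ^ suc r * Z p 1#) * (D * P) ∎
      where
      D = fromℕ p + (a + b)
      P = ∏ {r} (λ k → fromℕ (suc (toℕ k) ℕ.+ p) + (a + b))

  ℙ-separated : ∀ {α β} (α>0 : 0# < α) (β>0 : 0# < β) →
    let a   = 1/ α [ α>0 ]
        b   = 1/ β [ β>0 ]
        a>0 = 1/-positive α>0
        b>0 = 1/-positive β>0 in
    ∀ n {r} (j : Fin r → ℕ) (r≤n : r ≤ n) →
    (∀ k → 1 ≤ j k) → (∀ k → j k ℕ.< n) → StrictlyIncreasing j → Separated j →
    ℙ α>0 β>0 n (λ k → X? n (j k)) ≈
    ∏ (λ k → 1/ (fromℕ n + a + b - fromℕ r + fromℕ (suc (toℕ k)) - 1#)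
               [ denominator>0 a>0 b>0 n r≤n k ])
  ℙ-separated {α} {β} α>0 β>0 n {r} j r≤n lo hi inc sep
    with σ , enc ← encodable n j lo hi inc sep = begin
    ℙ α>0 β>0 n (λ k → X? n (j k))
      ≈⟨ ∑-cong E (λ S → *-comm (wt α>0 β>0 S) W⁻¹) ⟩
    ∑ E (λ S → W⁻¹ * wt α>0 β>0 S)
      ≈⟨ ∑-* E W⁻¹ _ ⟩
    W⁻¹ * ∑ E weight
      ≈⟨ *-congˡ (∑-events (λ S → Fin.all? (λ k → X? n (j k) S)) σ enc) ⟩
    W⁻¹ * N
      ≈⟨ *-identityʳ _ ⟨
    W⁻¹ * N * 1#
      -- Inserting `∏ d * ∏ e` reduces the claim to `N * ∏ d` being the total weight, which `W⁻¹`
      -- then cancels.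
      ≈⟨ *-congˡ (∏-inverse d e (λ k → trans (*-comm _ _) (1/-inverseˡ _))) ⟨
    W⁻¹ * N * (∏ d * ∏ e)
      ≈⟨ solve 4 (λ w n d e → (w :* n) :* (d :* e) := (w :* (n :* d)) :* e)
           ≈-refl W⁻¹ N (∏ d) (∏ e) ⟩
    W⁻¹ * (N * ∏ d) * ∏ e
      ≈⟨ *-congʳ (*-congˡ N*∏d≈W) ⟩
    W⁻¹ * totalWeight α>0 β>0 n * ∏ e
      ≈⟨ *-congʳ (1/-inverseˡ (totalWeight>0 α>0 β>0 n)) ⟩
    1# * ∏ e
      ≈⟨ *-identityˡ _ ⟩
    ∏ e ∎
    where
    a = 1/ α [ α>0 ]
    b = 1/ β [ β>0 ]
    open GeneratingFunction commutativeSemiring α β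
    E = List.filter (λ S → Fin.all? (λ k → X? n (j k) S)) (tableaux n)
    W⁻¹ = 1/ totalWeight α>0 β>0 n [ totalWeight>0 α>0 β>0 n ]
    N = (α * β) ^ r * Z (reduced σ) 1#
    d e : Fin r → Carrier
    d k = fromℕ n + a + b - fromℕ r + fromℕ (suc (toℕ k)) - 1#
    e k = 1/ d k [ denominator>0 (1/-positive α>0) (1/-positive β>0) n r≤n k ]

    reduced≡ : n ∸ r ≡ reduced σ
    reduced≡ = ≡.trans (≡.cong (_∸ r) (≡.sym (reduced+ σ))) (ℕ.m+n∸n≡m (reduced σ) r)

    N*∏d≈W : N * ∏ d ≈ totalWeight α>0 β>0 n
    N*∏d≈W = begin
      N * ∏ d
        ≈⟨ *-congˡ (∏-cong {r} λ k → trans (denominator≈ a b (toℕ k) r≤n)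
             (reflexive (≡.cong (λ m → fromℕ (toℕ k ℕ.+ m) + (a + b)) reduced≡))) ⟩
      N * ∏ {r} (λ k → fromℕ (toℕ k ℕ.+ reduced σ) + (a + b))
        ≈⟨ Z-+ (trans (*-comm _ _) (1/-inverseˡ α>0)) (trans (*-comm _ _) (1/-inverseˡ β>0))
             r (reduced σ) ⟨
      Z (r ℕ.+ reduced σ) 1#
        ≡⟨ ≡.cong (λ m → Z m 1#) (≡.trans (ℕ.+-comm r (reduced σ)) (reduced+ σ)) ⟩
      Z n 1#
        ≈⟨ ∑-tableaux n ⟨
      totalWeight α>0 β>0 n ∎

  -- No tableau survives the filter, so the probability is an empty sum.
  ℙ-not-separated : ∀ {α β} (α>0 : 0# < α) (β>0 : 0# < β) →
    ∀ n {r} (j : Fin r → ℕ) → (∀ k → j k ℕ.< n) → StrictlyIncreasing j → ¬ Separated j →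
    ℙ α>0 β>0 n (λ k → X? n (j k)) ≈ 0#
  ℙ-not-separated α>0 β>0 n j hi inc ¬sep = reflexive (≡.cong (sumᴸ ∘ List.map _)
    (List.filter-none _ (All.map (λ t x → ¬sep (tableau⇒separated hi inc t x))
      (All.all-filter isTableau? (allFillings n)))))

theorem3p8 :
    ∀ {c ℓ₁ ℓ₂ ℓ₃} (F : OrderedField c ℓ₁ ℓ₂ ℓ₃) →
    let open OrderedField F
        open Probability F in
    ∀ (n : ℕ) → 2 ≤ n →
    ∀ (α β : Carrier) (α>0 : 0# < α) (β>0 : 0# < β) →
    let a   = 1/ α [ α>0 ]
        b   = 1/ β [ β>0 ]
        a>0 = 1/-positive α>0
        b>0 = 1/-positive β>0 in
    -- j k is the index written j with subscript k + 1
    ∀ (r : ℕ) (j : Fin r → ℕ)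
      (1≤j : ∀ k → 1 ≤ j k) (j≤n-1 : ∀ k → j k ≤ n ∸ 1)
      (j-incr : StrictlyIncreasing j) →
      (Separated j →
        ℙ α>0 β>0 n (λ k → X? n (j k)) ≈
        ∏ (λ k → 1/ (fromℕ n + a + b - fromℕ r + fromℕ (suc (toℕ k)) - 1#)
                   [ denominator>0 a>0 b>0 n (length≤ j 1≤j j≤n-1 j-incr) k ]))
    × (¬ Separated j → ℙ α>0 β>0 n (λ k → X? n (j k)) ≈ 0#)
theorem3p8 F n@(suc _) 2≤n α β α>0 β>0 r j 1≤j j≤n-1 j-incr =
  -- With `n` matched as a successor, `n ∸ 1` computes and `s≤s` turns each upper bound into
  -- `j k < n`.
  ℙ-separated α>0 β>0 n j (length≤ j 1≤j j≤n-1 j-incr) 1≤j (λ k → ℕ.s≤s (j≤n-1 k)) j-incr ,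
  ℙ-not-separated α>0 β>0 n j (λ k → ℕ.s≤s (j≤n-1 k)) j-incr
  where open Field F
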